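{- Let $\mathcal{L}_{\mathrm{DLE}}=\mathcal{L}_{\mathrm{DLE}}(\mathcal{F},\mathcal{G})$ be any DLE-language, let $\mathbf{L}_{\mathbb{DLE}}$ be the minimal $\mathcal{L}_{\mathrm{DLE}}$-logic and let $\mathbf{L}^*_{\mathbb{DLE}}$ be the minimal $\mathcal{L}^*_{\mathrm{DLE}}$-logic in the expanded language $\mathcal{L}^*_{\mathrm{DLE}}=\mathcal{L}_{\mathrm{DLE}}(\mathcal{F}^*,\mathcal{G}^*)$. Then $\mathbf{L}^*_{\mathbb{DLE}}$ is a conservative extension of $\mathbf{L}_{\mathbb{DLE}}$: for every $\mathcal{L}_{\mathrm{DLE}}$-sequent $\phi\vdash\psi$, $\phi\vdash\psi$ is derivable in $\mathbf{L}_{\mathbb{DLE}}$ if and only if $\phi\vdash\psi$ is derivable in $\mathbf{L}^*_{\mathbb{DLE}}$.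
   Context: An order-type over $n\in\mathbb{N}$ is a tuple $\varepsilon\in\{1,\partial\}^n$; $\varepsilon^\partial$ is the opposite order-type (with $1$ and $\partial$ exchanged in every coordinate). Language. A DLE-language $\mathcal{L}_{\mathrm{DLE}}(\mathcal{F},\mathcal{G})$ has a denumerable set of propositional variables and disjoint finite sets $\mathcal{F},\mathcal{G}$ of connectives; each $f\in\mathcal{F}$ has an arity $n_f\in\mathbb{N}$ and an order-type $\varepsilon_f$ over $n_f$, each $g\in\mathcal{G}$ an arity $n_g$ and an order-type $\varepsilon_g$ over $n_g$. Formulas: $\phi::=p\mid\bot\mid\top\mid\phi\wedge\phi\mid\phi\vee\phi\mid f(\overline{\phi})\mid g(\overline{\phi})$. A sequent is an expression $\phi\vdash\psi$ with $\phi,\psi$ formulas. For a connective $h$, $h_i[\phi]$ denotes $h$ with $\phi$ in the $i$-th coordinate and arbitrary parameters in the other coordinates (the same parameters throughout one axiom or rule). Minimal logic. $\mathbf{L}_{\mathbb{DLE}}$ is the smallest set of sequents containing the axioms $p\vdash p$, $\bot\vdash p$, $p\vdash\top$, $p\wedge(q\vee r)\vdash(p\wedge q)\vee(p\wedge r)$, $p\vdash p\vee q$, $q\vdash p\vee q$, $p\wedge q\vdash p$, $p\wedge q\vdash q$; for $f\in\mathcal{F}$: $f_i[\bot]\vdash\bot$ and $f_i[p\vee q]\vdash f_i[p]\vee f_i[q]$ if $\varepsilon_f(i)=1$, and $f_i[\top]\vdash\bot$ and $f_i[p\wedge q]\vdash f_i[p]\vee f_i[q]$ if $\varepsilon_f(i)=\partial$;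 for $g\in\mathcal{G}$: $\top\vdash g_j[\top]$ and $g_j[p]\wedge g_j[q]\vdash g_j[p\wedge q]$ if $\varepsilon_g(j)=1$, and $\top\vdash g_j[\bot]$ and $g_j[p]\wedge g_j[q]\vdash g_j[p\vee q]$ if $\varepsilon_g(j)=\partial$; and closed under: from $\phi\vdash\chi$ and $\chi\vdash\psi$ infer $\phi\vdash\psi$; uniform substitution; from $\chi\vdash\phi$ and $\chi\vdash\psi$ infer $\chi\vdash\phi\wedge\psi$; from $\phi\vdash\chi$ and $\psi\vdash\chi$ infer $\phi\vee\psi\vdash\chi$; and for every $h\in\mathcal{F}\cup\mathcal{G}$, from $\phi\vdash\psi$ infer $h_i[\phi]\vdash h_i[\psi]$ if $\varepsilon_h(i)=1$, and infer $h_i[\psi]\vdash h_i[\phi]$ if $\varepsilon_h(i)=\partial$. Expanded language. $\mathcal{F}^*\supseteq\mathcal{F}$ and $\mathcal{G}^*\supseteq\mathcal{G}$ are obtained by adding: binary connectives $\to_H,\leftarrow_H\in\mathcal{G}^*$ (order-types $(\partial,1)$ and $(1,\partial)$) and binary connectives $\succ,\prec\,\in\mathcal{F}^*$ (order-types $(1,\partial)$ and $(\partial,1)$); for each $f\in\mathcal{F}$ and $1\le i\le n_f$ an $n_f$-ary connective $f_i^\sharp$, which is in $\mathcal{G}^*$ if $\varepsilon_f(i)=1$ and in $\mathcal{F}^*$ if $\varepsilon_f(i)=\partial$; for each $g\in\mathcal{G}$ and $1\le j\le n_g$ an $n_g$-ary connective $g_j^\flat$, which is in $\mathcal{F}^*$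 if $\varepsilon_g(j)=1$ and in $\mathcal{G}^*$ if $\varepsilon_g(j)=\partial$. The order-types are those forced by the intended interpretation as residuals/Galois-adjoints: for $h^\bullet_i\in\{f_i^\sharp,g_i^\flat\}$ obtained from $h$, if $\varepsilon_h(i)=1$ the order-type is $1$ at $i$ and $\varepsilon_h^\partial(j)$ at $j\neq i$; if $\varepsilon_h(i)=\partial$ it is $\partial$ at $i$ and $\varepsilon_h(j)$ at $j\ne i$. $\mathbf{L}^*_{\mathbb{DLE}}$ is the smallest set of sequents of the language $\mathcal{L}_{\mathrm{DLE}}(\mathcal{F}^*,\mathcal{G}^*)$ containing the axioms $p\vdash p$, $\bot\vdash p$, $p\vdash\top$, $p\wedge(q\vee r)\vdash(p\wedge q)\vee(p\wedge r)$, $p\vdash p\vee q$, $q\vdash p\vee q$, $p\wedge q\vdash p$, $p\wedge q\vdash q$; for $f\in\mathcal{F}^*$: $f_i[\bot]\vdash\bot$ and $f_i[p\vee q]\vdash f_i[p]\vee f_i[q]$ if $\varepsilon_f(i)=1$, and $f_i[\top]\vdash\bot$ and $f_i[p\wedge q]\vdash f_i[p]\vee f_i[q]$ if $\varepsilon_f(i)=\partial$; for $g\in\mathcal{G}^*$: $\top\vdash g_j[\top]$ and $g_j[p]\wedge g_j[q]\vdash g_j[p\wedge q]$ if $\varepsilon_g(j)=1$, and $\top\vdash g_j[\bot]$ and $g_j[p]\wedge g_j[q]\vdash g_j[p\vee q]$ if $\varepsilon_g(j)=\partial$; closed under: from $\phi\vdash\chi$ and $\chi\vdash\psi$ infer $\phi\vdash\psi$;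 uniform substitution; from $\chi\vdash\phi$ and $\chi\vdash\psi$ infer $\chi\vdash\phi\wedge\psi$; from $\phi\vdash\chi$ and $\psi\vdash\chi$ infer $\phi\vee\psi\vdash\chi$; for every $h\in\mathcal{F}^*\cup\mathcal{G}^*$, from $\phi\vdash\psi$ infer $h_i[\phi]\vdash h_i[\psi]$ if $\varepsilon_h(i)=1$, and infer $h_i[\psi]\vdash h_i[\phi]$ if $\varepsilon_h(i)=\partial$; and additionally closed under the following rules in both directions: $\phi\wedge\psi\vdash\chi$ iff $\psi\vdash\phi\to_H\chi$; $\phi\wedge\psi\vdash\chi$ iff $\phi\vdash\chi\leftarrow_H\psi$; $\phi\vdash\psi\vee\chi$ iff $\psi\prec\phi\vdash\chi$; $\phi\vdash\psi\vee\chi$ iff $\phi\succ\chi\vdash\psi$; for $f\in\mathcal{F}$: $f_i[\phi]\vdash\psi$ iff $\phi\vdash f_i^\sharp[\psi]$ when $\varepsilon_f(i)=1$, and $f_i[\phi]\vdash\psi$ iff $f_i^\sharp[\psi]\vdash\phi$ when $\varepsilon_f(i)=\partial$; for $g\in\mathcal{G}$: $\phi\vdash g_j[\psi]$ iff $g_j^\flat[\phi]\vdash\psi$ when $\varepsilon_g(j)=1$, and $\phi\vdash g_j[\psi]$ iff $\psi\vdash g_j^\flat[\phi]$ when $\varepsilon_g(j)=\partial$ (same parameters on both sides). -}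

module Defs where

open import Axiom.UniquenessOfIdentityProofs using (module Decidable⇒UIP)
open import Data.Fin using (Fin; zero; suc)
open import Data.Fin.Properties using (+↔⊎)
open import Data.Nat using (ℕ; _+_)
open import Data.Product using (Σ; ∃; _,_)
open import Data.Product.Function.Dependent.Propositional using (Σ-↔)
open import Data.Sum using (_⊎_; inj₁; inj₂)
open import Data.Sum.Function.Propositional using (_⊎-↔_)
open import Data.Vec using (Vec; []; _∷_; lookup; map; _[_]≔_)
open import Function.Bundles using (_↔_; mk↔ₛ′; Inverse)
open import Function.Construct.Composition using (_↔-∘_)
open import Function.Construct.Identity using (↔-id)
open import Relation.Binary.Construct.Closure.Symmetric using (SymClosure)
open import Relation.Binary.Construct.Never using (Never)
open import Relation.Binary.Definitions using (DecidableEquality)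
open import Relation.Binary.PropositionalEquality using (_≡_; refl)
open import Relation.Nullary using (Dec; yes; no; contradiction)

Finite : Set → Set
Finite A = ∃ λ n → Fin n ↔ A

finite-⊎ : ∀ {A B : Set} → Finite A → Finite B → Finite (A ⊎ B)
finite-⊎ (m , a) (n , b) = m + n , (a ⊎-↔ b) ↔-∘ +↔⊎

finite-map : ∀ {A B : Set} → A ↔ B → Finite A → Finite B
finite-map e (n , a) = n , e ↔-∘ a

finite-Σ-Fin : ∀ n {B : Fin n → Set} → (∀ i → Finite (B i)) → Finite (Σ (Fin n) B)
finite-Σ-Fin ℕ.zero b = 0 , mk↔ₛ′ (λ ()) (λ { (() , _) }) (λ { (() , _) }) (λ ())
finite-Σ-Fin (ℕ.suc n) {B} b =
  finite-map split (finite-⊎ (b zero) (finite-Σ-Fin n (λ i → b (suc i))))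
  where
  split : (B zero ⊎ Σ (Fin n) (λ i → B (suc i))) ↔ Σ (Fin (ℕ.suc n)) B
  split = mk↔ₛ′
    (λ { (inj₁ x) → zero , x ; (inj₂ (i , x)) → suc i , x })
    (λ { (zero , x) → inj₁ x ; (suc i , x) → inj₂ (i , x) })
    (λ { (zero , x) → refl ; (suc i , x) → refl })
    (λ { (inj₁ x) → refl ; (inj₂ (i , x)) → refl })

finite-Σ : ∀ {A : Set} {B : A → Set} → Finite A → (∀ a → Finite (B a)) → Finite (Σ A B)
finite-Σ {B = B} (n , a) b =
  finite-map (Σ-↔ {B = B} a (↔-id _)) (finite-Σ-Fin n (λ i → b (Inverse.to a i)))

finite-dec : ∀ {A : Set} → Dec A → (∀ (x y : A) → x ≡ y) → Finite A
finite-dec (yes x) irr = 1 , mk↔ₛ′ (λ _ → x) (λ _ → zero) (irr x) (λ { zero → refl ; (suc ()) })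
finite-dec (no ¬x) irr =
  0 , mk↔ₛ′ (λ ()) (λ x → contradiction x ¬x) (λ x → contradiction x ¬x) (λ ())

data Sign : Set where
  𝟏 ∂ : Sign

_≟ˢ_ : DecidableEquality Sign
𝟏 ≟ˢ 𝟏 = yes refl
𝟏 ≟ˢ ∂ = no (λ ())
∂ ≟ˢ 𝟏 = no (λ ())
∂ ≟ˢ ∂ = yes refl

finite-≡ˢ : ∀ (s t : Sign) → Finite (s ≡ t)
finite-≡ˢ s t = finite-dec (s ≟ˢ t) (Decidable⇒UIP.≡-irrelevant _≟ˢ_)

flip : Sign → Sign
flip 𝟏 = ∂
flip ∂ = 𝟏

OrderType : ℕ → Set
OrderType n = Vec Sign n

opposite : ∀ {n} → OrderType n → OrderType n
opposite = map flip

-- Disjointness of the two families of connectives is enforced by taking h ∈ F ∪ G to be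
-- h : F ⊎ G.
record DLELanguage : Set₁ where
  field
    F G       : Set
    F-finite  : Finite F
    G-finite  : Finite G
    arity     : F ⊎ G → ℕ
    orderType : ∀ h → OrderType (arity h)

  ε : ∀ h → Fin (arity h) → Sign
  ε h = lookup (orderType h)

open DLELanguage public

infixr 7 _∧_
infixr 6 _∨_

data Formula (L : DLELanguage) : Set where
  var     : ℕ → Formula L
  ⊥ ⊤     : Formula L
  _∧_ _∨_ : Formula L → Formula L → Formula L
  op      : (h : F L ⊎ G L) → Vec (Formula L) (arity L h) → Formula L

-- h_i[φ]: the i-th entry of the vector γ is discarded, the others are the parameters.
_⟨_⟩[_≔_] : ∀ {L} (h : F L ⊎ G L) → Vec (Formula L) (arity L h) →
            Fin (arity L h) → Formula L → Formula L
h ⟨ γ ⟩[ i ≔ φ ] = op h (γ [ i ]≔ φ)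

sub  : ∀ {L} → (ℕ → Formula L) → Formula L → Formula L
subs : ∀ {L n} → (ℕ → Formula L) → Vec (Formula L) n → Vec (Formula L) n
sub σ (var p)  = σ p
sub σ ⊥        = ⊥
sub σ ⊤        = ⊤
sub σ (φ ∧ ψ)  = sub σ φ ∧ sub σ ψ
sub σ (φ ∨ ψ)  = sub σ φ ∨ sub σ ψ
sub σ (op h γ) = op h (subs σ γ)
subs σ []      = []
subs σ (φ ∷ γ) = sub σ φ ∷ subs σ γ

infix 4 _⊢_

record Sequent (L : DLELanguage) : Set where
  constructor _⊢_
  field
    antecedent succedent : Formula L

-- The least set of sequents closed under the axioms and rules of the minimal logic of L
-- and, in addition, under the one-premise rules in Rule (from s infer t whenever
-- Rule s t).
data Derivable {L : DLELanguage} (Rule : Sequent L → Sequent L → Set) : Sequent L → Set where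
  ax      : ∀ p → Derivable Rule (var p ⊢ var p)
  ax-⊥    : ∀ p → Derivable Rule (⊥ ⊢ var p)
  ax-⊤    : ∀ p → Derivable Rule (var p ⊢ ⊤)
  distrib : ∀ p q r → Derivable Rule
              (var p ∧ (var q ∨ var r) ⊢ (var p ∧ var q) ∨ (var p ∧ var r))
  ax-∨₁   : ∀ p q → Derivable Rule (var p ⊢ var p ∨ var q)
  ax-∨₂   : ∀ p q → Derivable Rule (var q ⊢ var p ∨ var q)
  ax-∧₁   : ∀ p q → Derivable Rule (var p ∧ var q ⊢ var p)
  ax-∧₂   : ∀ p q → Derivable Rule (var p ∧ var q ⊢ var q)

  f-⊥ : ∀ f γ i → ε L (inj₁ f) i ≡ 𝟏 →
        Derivable Rule (inj₁ f ⟨ γ ⟩[ i ≔ ⊥ ] ⊢ ⊥)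
  f-∨ : ∀ f γ i → ε L (inj₁ f) i ≡ 𝟏 → ∀ p q →
        Derivable Rule (inj₁ f ⟨ γ ⟩[ i ≔ var p ∨ var q ] ⊢
                        inj₁ f ⟨ γ ⟩[ i ≔ var p ] ∨ inj₁ f ⟨ γ ⟩[ i ≔ var q ])
  f-⊤ : ∀ f γ i → ε L (inj₁ f) i ≡ ∂ →
        Derivable Rule (inj₁ f ⟨ γ ⟩[ i ≔ ⊤ ] ⊢ ⊥)
  f-∧ : ∀ f γ i → ε L (inj₁ f) i ≡ ∂ → ∀ p q →
        Derivable Rule (inj₁ f ⟨ γ ⟩[ i ≔ var p ∧ var q ] ⊢
                        inj₁ f ⟨ γ ⟩[ i ≔ var p ] ∨ inj₁ f ⟨ γ ⟩[ i ≔ var q ])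

  g-⊤ : ∀ g γ j → ε L (inj₂ g) j ≡ 𝟏 →
        Derivable Rule (⊤ ⊢ inj₂ g ⟨ γ ⟩[ j ≔ ⊤ ])
  g-∧ : ∀ g γ j → ε L (inj₂ g) j ≡ 𝟏 → ∀ p q →
        Derivable Rule (inj₂ g ⟨ γ ⟩[ j ≔ var p ] ∧ inj₂ g ⟨ γ ⟩[ j ≔ var q ] ⊢
                        inj₂ g ⟨ γ ⟩[ j ≔ var p ∧ var q ])
  g-⊥ : ∀ g γ j → ε L (inj₂ g) j ≡ ∂ →
        Derivable Rule (⊤ ⊢ inj₂ g ⟨ γ ⟩[ j ≔ ⊥ ])
  g-∨ : ∀ g γ j → ε L (inj₂ g) j ≡ ∂ → ∀ p q →
        Derivable Rule (inj₂ g ⟨ γ ⟩[ j ≔ var p ] ∧ inj₂ g ⟨ γ ⟩[ j ≔ var q ] ⊢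
                        inj₂ g ⟨ γ ⟩[ j ≔ var p ∨ var q ])

  cut   : ∀ {φ χ ψ} → Derivable Rule (φ ⊢ χ) → Derivable Rule (χ ⊢ ψ) →
          Derivable Rule (φ ⊢ ψ)
  subst : ∀ {φ ψ} (σ : ℕ → Formula L) → Derivable Rule (φ ⊢ ψ) →
          Derivable Rule (sub σ φ ⊢ sub σ ψ)
  ∧-intro : ∀ {χ φ ψ} → Derivable Rule (χ ⊢ φ) → Derivable Rule (χ ⊢ ψ) →
            Derivable Rule (χ ⊢ φ ∧ ψ)
  ∨-elim  : ∀ {φ ψ χ} → Derivable Rule (φ ⊢ χ) → Derivable Rule (ψ ⊢ χ) →
            Derivable Rule (φ ∨ ψ ⊢ χ)
  mono : ∀ h γ i → ε L h i ≡ 𝟏 → ∀ {φ ψ} → Derivable Rule (φ ⊢ ψ) →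
         Derivable Rule (h ⟨ γ ⟩[ i ≔ φ ] ⊢ h ⟨ γ ⟩[ i ≔ ψ ])
  anti : ∀ h γ i → ε L h i ≡ ∂ → ∀ {φ ψ} → Derivable Rule (φ ⊢ ψ) →
         Derivable Rule (h ⟨ γ ⟩[ i ≔ ψ ] ⊢ h ⟨ γ ⟩[ i ≔ φ ])

  rule : ∀ {s t} → Rule s t → Derivable Rule s → Derivable Rule t

𝐋 : (L : DLELanguage) → Sequent L → Set
𝐋 L = Derivable Never

module Expansion (L : DLELanguage) where

  data F* : Set where
    old   : F L → F*
    ≻ ≺   : F*
    sharp : ∀ f i → ε L (inj₁ f) i ≡ ∂ → F*
    flat  : ∀ g j → ε L (inj₂ g) j ≡ 𝟏 → F*

  data G* : Set where
    old   : G L → G*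
    →ᴴ ←ᴴ : G*
    sharp : ∀ f i → ε L (inj₁ f) i ≡ 𝟏 → G*
    flat  : ∀ g j → ε L (inj₂ g) j ≡ ∂ → G*

  Coord : ∀ {A : Set} → (A → F L ⊎ G L) → Sign → Set
  Coord {A} inj s = Σ A λ h → Σ (Fin (arity L (inj h))) λ i → ε L (inj h) i ≡ s

  finite-Coord : ∀ {A : Set} (inj : A → F L ⊎ G L) s → Finite A → Finite (Coord inj s)
  finite-Coord inj s a = finite-Σ a λ h → finite-Σ (_ , ↔-id _) λ i → finite-≡ˢ _ s

  F*-finite : Finite F*
  F*-finite = finite-map
    (mk↔ₛ′
      (λ { (inj₁ f) → old f
         ; (inj₂ (inj₁ zero)) → ≻
         ; (inj₂ (inj₁ (suc zero))) → ≺
         ; (inj₂ (inj₂ (inj₁ (f , i , e)))) → sharp f i e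
         ; (inj₂ (inj₂ (inj₂ (g , j , e)))) → flat g j e })
      (λ { (old f) → inj₁ f
         ; ≻ → inj₂ (inj₁ zero)
         ; ≺ → inj₂ (inj₁ (suc zero))
         ; (sharp f i e) → inj₂ (inj₂ (inj₁ (f , i , e)))
         ; (flat g j e) → inj₂ (inj₂ (inj₂ (g , j , e))) })
      (λ { (old f) → refl ; ≻ → refl ; ≺ → refl
         ; (sharp f i e) → refl ; (flat g j e) → refl })
      (λ { (inj₁ f) → refl
         ; (inj₂ (inj₁ zero)) → refl
         ; (inj₂ (inj₁ (suc zero))) → refl
         ; (inj₂ (inj₂ (inj₁ _))) → refl
         ; (inj₂ (inj₂ (inj₂ _))) → refl }))
    (finite-⊎ (F-finite L) (finite-⊎ (2 , ↔-id _)
      (finite-⊎ (finite-Coord inj₁ ∂ (F-finite L)) (finite-Coord inj₂ 𝟏 (G-finite L)))))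

  G*-finite : Finite G*
  G*-finite = finite-map
    (mk↔ₛ′
      (λ { (inj₁ g) → old g
         ; (inj₂ (inj₁ zero)) → →ᴴ
         ; (inj₂ (inj₁ (suc zero))) → ←ᴴ
         ; (inj₂ (inj₂ (inj₁ (f , i , e)))) → sharp f i e
         ; (inj₂ (inj₂ (inj₂ (g , j , e)))) → flat g j e })
      (λ { (old g) → inj₁ g
         ; →ᴴ → inj₂ (inj₁ zero)
         ; ←ᴴ → inj₂ (inj₁ (suc zero))
         ; (sharp f i e) → inj₂ (inj₂ (inj₁ (f , i , e)))
         ; (flat g j e) → inj₂ (inj₂ (inj₂ (g , j , e))) })
      (λ { (old g) → refl ; →ᴴ → refl ; ←ᴴ → refl
         ; (sharp f i e) → refl ; (flat g j e) → refl })
      (λ { (inj₁ g) → refl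
         ; (inj₂ (inj₁ zero)) → refl
         ; (inj₂ (inj₁ (suc zero))) → refl
         ; (inj₂ (inj₂ (inj₁ _))) → refl
         ; (inj₂ (inj₂ (inj₂ _))) → refl }))
    (finite-⊎ (G-finite L) (finite-⊎ (2 , ↔-id _)
      (finite-⊎ (finite-Coord inj₁ 𝟏 (F-finite L)) (finite-Coord inj₂ ∂ (G-finite L)))))

  arity* : F* ⊎ G* → ℕ
  arity* (inj₁ (old f))       = arity L (inj₁ f)
  arity* (inj₁ ≻)             = 2
  arity* (inj₁ ≺)             = 2
  arity* (inj₁ (sharp f _ _)) = arity L (inj₁ f)
  arity* (inj₁ (flat g _ _))  = arity L (inj₂ g)
  arity* (inj₂ (old g))       = arity L (inj₂ g)
  arity* (inj₂ →ᴴ)            = 2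
  arity* (inj₂ ←ᴴ)            = 2
  arity* (inj₂ (sharp f _ _)) = arity L (inj₁ f)
  arity* (inj₂ (flat g _ _))  = arity L (inj₂ g)

  -- Order-type of the residual in coordinate i of a connective of order-type η, where s
  -- is the i-th entry of η.
  residual : ∀ {n} → Sign → OrderType n → Fin n → OrderType n
  residual 𝟏 η i = opposite η [ i ]≔ 𝟏
  residual ∂ η i = η [ i ]≔ ∂

  orderType* : ∀ h → OrderType (arity* h)
  orderType* (inj₁ (old f))       = orderType L (inj₁ f)
  orderType* (inj₁ ≻)             = 𝟏 ∷ ∂ ∷ []
  orderType* (inj₁ ≺)             = ∂ ∷ 𝟏 ∷ []
  orderType* (inj₁ (sharp f i _)) = residual ∂ (orderType L (inj₁ f)) i
  orderType* (inj₁ (flat g j _))  = residual 𝟏 (orderType L (inj₂ g)) j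
  orderType* (inj₂ (old g))       = orderType L (inj₂ g)
  orderType* (inj₂ →ᴴ)            = ∂ ∷ 𝟏 ∷ []
  orderType* (inj₂ ←ᴴ)            = 𝟏 ∷ ∂ ∷ []
  orderType* (inj₂ (sharp f i _)) = residual 𝟏 (orderType L (inj₁ f)) i
  orderType* (inj₂ (flat g j _))  = residual ∂ (orderType L (inj₂ g)) j

  L* : DLELanguage
  L* = record
    { F = F* ; G = G* ; F-finite = F*-finite ; G-finite = G*-finite
    ; arity = arity* ; orderType = orderType* }

  embed  : Formula L → Formula L*
  embeds : ∀ {n} → Vec (Formula L) n → Vec (Formula L*) n
  embed (var p)         = var p
  embed ⊥               = ⊥
  embed ⊤               = ⊤
  embed (φ ∧ ψ)         = embed φ ∧ embed ψ
  embed (φ ∨ ψ)         = embed φ ∨ embed ψ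
  embed (op (inj₁ f) γ) = op (inj₁ (old f)) (embeds γ)
  embed (op (inj₂ g) γ) = op (inj₂ (old g)) (embeds γ)
  embeds []      = []
  embeds (φ ∷ γ) = embed φ ∷ embeds γ

  -- One direction of each two-way rule; SymClosure supplies the other.
  data Residuation : Sequent L* → Sequent L* → Set where
    →ᴴ-adj : ∀ φ ψ χ → Residuation
      (φ ∧ ψ ⊢ χ) (ψ ⊢ op (inj₂ →ᴴ) (φ ∷ χ ∷ []))
    ←ᴴ-adj : ∀ φ ψ χ → Residuation
      (φ ∧ ψ ⊢ χ) (φ ⊢ op (inj₂ ←ᴴ) (χ ∷ ψ ∷ []))
    ≺-adj  : ∀ φ ψ χ → Residuation
      (φ ⊢ ψ ∨ χ) (op (inj₁ ≺) (ψ ∷ φ ∷ []) ⊢ χ)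
    ≻-adj  : ∀ φ ψ χ → Residuation
      (φ ⊢ ψ ∨ χ) (op (inj₁ ≻) (φ ∷ χ ∷ []) ⊢ ψ)
    sharp-𝟏 : ∀ f i e (γ : Vec (Formula L*) (arity L (inj₁ f))) φ ψ → Residuation
      (inj₁ (old f) ⟨ γ ⟩[ i ≔ φ ] ⊢ ψ) (φ ⊢ inj₂ (sharp f i e) ⟨ γ ⟩[ i ≔ ψ ])
    sharp-∂ : ∀ f i e (γ : Vec (Formula L*) (arity L (inj₁ f))) φ ψ → Residuation
      (inj₁ (old f) ⟨ γ ⟩[ i ≔ φ ] ⊢ ψ) (inj₁ (sharp f i e) ⟨ γ ⟩[ i ≔ ψ ] ⊢ φ)
    flat-𝟏  : ∀ g j e (γ : Vec (Formula L*) (arity L (inj₂ g))) φ ψ → Residuation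
      (φ ⊢ inj₂ (old g) ⟨ γ ⟩[ j ≔ ψ ]) (inj₁ (flat g j e) ⟨ γ ⟩[ j ≔ φ ] ⊢ ψ)
    flat-∂  : ∀ g j e (γ : Vec (Formula L*) (arity L (inj₂ g))) φ ψ → Residuation
      (φ ⊢ inj₂ (old g) ⟨ γ ⟩[ j ≔ ψ ]) (ψ ⊢ inj₂ (flat g j e) ⟨ γ ⟩[ j ≔ φ ])

  𝐋* : Sequent L* → Set
  𝐋* = Derivable (SymClosure Residuation)

{-# OPTIONS --safe #-}
module Submission where

-- A derivation in the minimal logic of L becomes one in the expanded logic by embedding
-- every formula in it, since embedding commutes with substitution and with the
-- replacement of an argument.
--
-- The converse is algebraic: the Lindenbaum algebra of L is embedded in a lattice in which
-- every connective has a residual in each coordinate and which is both a Heyting and a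
-- co-Heyting algebra. That lattice is the canonical extension, built without prime filters
-- so that the argument is constructive. Its elements are pairs of a set of filters and a
-- set of ideals, polar to each other under the relation of having a common member.
--
-- Let h be a normal operator, the x_j filters or ideals according to the order-type of h,
-- and y an ideal (a filter if h is in G). Consider the relation "some value of h on
-- members of the x_j lies in y". It says that the filter (the ideal, if h is in G)
-- generated by such values meets y; and, for each i, it says that x_i meets the set of all
-- b such that h takes a value in y on b and members of the other x_j. Because h is normal,
-- that set is an ideal (a filter if x_i is an ideal). The two readings of the relation
-- (image-≬) define the extension of h and its residuals, and their equivalence is
-- residuation. By distributivity, ∧ and ∨ are normal operators too. Their extensions are
-- meet and join in the new lattice, since a filter contains the top and is closed under
-- meets, and dually for ideals; their residuals interpret the added binary connectives.
--
-- A residual of h is itself residuated in each coordinate, by h or by another residual of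
-- h (residualExt-adjoint). So every connective of the expanded language has an adjoint in
-- each coordinate. This makes it monotone and normal, and soundness follows. Finally the
-- interpretation of an embedded formula, with each variable sent to its class, is the
-- class of that formula (truth), and the embedding of the Lindenbaum algebra reflects the
-- order (represents-⊑). So what is derivable in the expanded logic is derivable in L.

open import Defs
open import Function.Bundles using (_⇔_)

open import Algebra.Core using (Op₂)
open import Algebra.Definitions using (_DistributesOverˡ_)
open import Data.Fin using (Fin; zero; suc; _≟_)
open import Data.Nat using (ℕ)
open import Data.Product using (∃; _×_; _,_; proj₁; proj₂)
open import Data.Sum using (_⊎_; inj₁; inj₂)
open import Data.Vec using (Vec; []; _∷_; lookup; map; tabulate; _[_]≔_)
open import Data.Vec.Properties using
  ( lookup∘update; lookup∘update′; lookup∘tabulate; lookup-map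
  ; []≔-lookup; []≔-commutes; map-[]≔; map-∘; map-cong; map-id )
open import Function.Base using (_∘_; id)
open import Function.Bundles using (mk⇔; module Equivalence)
open import Function.Construct.Composition using (_⇔-∘_)
open import Function.Construct.Symmetry using (⇔-sym)
open import Level using (Level; Lift; 0ℓ; lift; lower) renaming (suc to ℓsuc)
open import Relation.Binary.Construct.Closure.Symmetric using (fwd; bwd)
open import Relation.Binary.Construct.Never using (Never)
open import Relation.Binary.Lattice.Bundles using (BoundedLattice; DistributiveLattice)
import Relation.Binary.Lattice.Properties.DistributiveLattice as DistributiveLatticeProperties
open import Relation.Binary.PropositionalEquality
  using (_≡_; _≢_; refl; sym; trans; cong; cong₂; subst₂) renaming (subst to transport)
open import Relation.Nullary using (yes; no)
open import Relation.Unary using (Pred; _≬_)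
open import Relation.Unary.Properties using (≬-sym)

open Equivalence using (to; from)

-- Signs

infixr 8 _·_

-- The product of signs, with 𝟏 neutral and ∂ · ∂ equal to 𝟏.
_·_ : Sign → Sign → Sign
𝟏 · t = t
∂ · t = flip t

flip-flip : ∀ s → flip (flip s) ≡ s
flip-flip 𝟏 = refl
flip-flip ∂ = refl

-- Vectors compared coordinatewise, possibly away from one coordinate

module _ {a b ℓ : Level} {A : Set a} {B : Set b} {n : ℕ} (P : Fin n → A → B → Set ℓ) where

  Everywhere : Vec A n → Vec B n → Set ℓ
  Everywhere as bs = ∀ j → P j (lookup as j) (lookup bs j)

  AwayFrom : Fin n → Vec A n → Vec B n → Set ℓ
  AwayFrom i as bs = ∀ j → j ≢ i → P j (lookup as j) (lookup bs j)

module _ {a b ℓ : Level} {A : Set a} {B : Set b} {n : ℕ} (P : Fin n → A → B → Set ℓ)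
         (i : Fin n) (as : Vec A n) (bs : Vec B n) where

  fill : ∀ {x y} → AwayFrom P i as bs → P i x y → Everywhere P (as [ i ]≔ x) (bs [ i ]≔ y)
  fill {x} {y} off on j with j ≟ i
  ... | yes refl = subst₂ (P i) (sym (lookup∘update i as x)) (sym (lookup∘update i bs y)) on
  ... | no j≢i   = subst₂ (P j) (sym (lookup∘update′ j≢i as x))
                     (sym (lookup∘update′ j≢i bs y)) (off j j≢i)

  away-update : ∀ {y} → AwayFrom P i as bs → AwayFrom P i as (bs [ i ]≔ y)
  away-update {y} off j j≢i =
    transport (P j (lookup as j)) (sym (lookup∘update′ j≢i bs y)) (off j j≢i)

  away-restore : ∀ {y} → AwayFrom P i as (bs [ i ]≔ y) → AwayFrom P i as bs
  away-restore {y} off j j≢i =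
    transport (P j (lookup as j)) (lookup∘update′ j≢i bs y) (off j j≢i)

  at-updated : ∀ {y} → Everywhere P as (bs [ i ]≔ y) → P i (lookup as i) y
  at-updated {y} all = transport (P i (lookup as i)) (lookup∘update i bs y) (all i)

-- The changes are made one coordinate at a time.
monotone-everywhere :
  ∀ {a b ℓ ℓ′} {A : Set a} {B : Set b} (_≤_ : B → B → Set ℓ) →
  (∀ {x} → x ≤ x) → (∀ {x y z} → x ≤ y → y ≤ z → x ≤ z) →
  ∀ {n} (P : Fin n → A → A → Set ℓ′) (h : Vec A n → B) →
  (∀ i as {x y} → P i x y → h (as [ i ]≔ x) ≤ h (as [ i ]≔ y)) →
  ∀ {as bs} → Everywhere P as bs → h as ≤ h bs
monotone-everywhere _≤_ ≤-refl ≤-trans P h mon {[]} {[]} all = ≤-refl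
monotone-everywhere _≤_ ≤-refl ≤-trans P h mon {x ∷ as} {y ∷ bs} all =
  ≤-trans (mon zero (x ∷ as) (all zero))
    (monotone-everywhere _≤_ ≤-refl ≤-trans (P ∘ suc) (h ∘ (y ∷_))
      (λ i cs → mon (suc i) (y ∷ cs)) (all ∘ suc))

-- The canonical extension of a bounded distributive lattice

module CanonicalExtension
  (A : BoundedLattice 0ℓ 0ℓ 0ℓ)
  (∧-distrib : _DistributesOverˡ_
    (BoundedLattice._≈_ A) (BoundedLattice._∧_ A) (BoundedLattice._∨_ A))
  where

  private
    module A = BoundedLattice A
    open A using (Carrier)

    distributiveLattice : DistributiveLattice 0ℓ 0ℓ 0ℓ
    distributiveLattice = record
      { isDistributiveLattice = record { isLattice = A.isLattice ; ∧-distribˡ-∨ = ∧-distrib } }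

  -- For the sign ∂ the lattice is turned upside down: every notion below that carries a
  -- sign s is the notion named, read in the lattice when s is 𝟏 and in its dual when s
  -- is ∂.
  infix 4 _≤[_]_

  _≤[_]_ : Carrier → Sign → Carrier → Set
  x ≤[ 𝟏 ] y = x A.≤ y
  x ≤[ ∂ ] y = y A.≤ x

  top : Sign → Carrier
  top 𝟏 = A.⊤
  top ∂ = A.⊥

  bot : Sign → Carrier
  bot s = top (flip s)

  meet : Sign → Op₂ Carrier
  meet 𝟏 = A._∧_
  meet ∂ = A._∨_

  join : Sign → Op₂ Carrier
  join s = meet (flip s)

  ≤-refl : ∀ s {x} → x ≤[ s ] x
  ≤-refl 𝟏 = A.refl
  ≤-refl ∂ = A.refl

  ≤-trans : ∀ s {x y z} → x ≤[ s ] y → y ≤[ s ] z → x ≤[ s ] z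
  ≤-trans 𝟏 p q = A.trans p q
  ≤-trans ∂ p q = A.trans q p

  ≤-dual : ∀ s {x y} → x ≤[ s ] y → y ≤[ flip s ] x
  ≤-dual 𝟏 p = p
  ≤-dual ∂ p = p

  ≤-undual : ∀ s {x y} → y ≤[ flip s ] x → x ≤[ s ] y
  ≤-undual 𝟏 p = p
  ≤-undual ∂ p = p

  ≤-top : ∀ s x → x ≤[ s ] top s
  ≤-top 𝟏 = A.maximum
  ≤-top ∂ = A.minimum

  meet-≤₁ : ∀ s x y → meet s x y ≤[ s ] x
  meet-≤₁ 𝟏 = A.x∧y≤x
  meet-≤₁ ∂ = A.x≤x∨y

  meet-≤₂ : ∀ s x y → meet s x y ≤[ s ] y
  meet-≤₂ 𝟏 = A.x∧y≤y
  meet-≤₂ ∂ = A.y≤x∨y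

  meet-greatest : ∀ s {x y z} → z ≤[ s ] x → z ≤[ s ] y → z ≤[ s ] meet s x y
  meet-greatest 𝟏 = A.∧-greatest
  meet-greatest ∂ = A.∨-least

  meet-distribˡ : ∀ s x y z →
    meet s x (join s y z) ≤[ s ] join s (meet s x y) (meet s x z)
  meet-distribˡ 𝟏 x y z = A.reflexive (∧-distrib x y z)
  meet-distribˡ ∂ x y z = A.reflexive
    (A.Eq.sym (DistributiveLatticeProperties.∨-distribˡ-∧ distributiveLattice x y z))

  meet-distribʳ : ∀ s x y z →
    meet s (join s y z) x ≤[ s ] join s (meet s y x) (meet s z x)
  meet-distribʳ 𝟏 x y z = A.reflexive
    (DistributiveLatticeProperties.∧-distribʳ-∨ distributiveLattice x y z)
  meet-distribʳ ∂ x y z = A.reflexive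
    (A.Eq.sym (DistributiveLatticeProperties.∨-distribʳ-∧ distributiveLattice x y z))

  Subset : Set₁
  Subset = Pred Carrier 0ℓ

  -- An s-filter is a filter for s = 𝟏 and an ideal for s = ∂, not necessarily proper.
  record IsFilter (s : Sign) (X : Subset) : Set where
    field
      up     : ∀ {x y} → x ≤[ s ] y → X x → X y
      ∋top   : X (top s)
      ∋meet  : ∀ {x y} → X x → X y → X (meet s x y)

  open IsFilter

  principal : Sign → Carrier → Subset
  principal s x y = x ≤[ s ] y

  principal-isFilter : ∀ s x → IsFilter s (principal s x)
  principal-isFilter s x = record
    { up = λ p q → ≤-trans s q p ; ∋top = ≤-top s x ; ∋meet = meet-greatest s }

  -- An element of the canonical extension: a set of filters (at 𝟏) and a set of ideals
  -- (at ∂), each the polar of the other under the relation of having a common member.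
  -- The filters are those representing closed elements below it, the ideals are those
  -- representing open elements above it.
  record Elem : Set₂ where
    field
      at       : Sign → Subset → Set₁
      isFilter : ∀ s {X} → at s X → IsFilter s X
      sound    : ∀ s {X Y} → at s X → at (flip s) Y → X ≬ Y
      stable   : ∀ s {X} → IsFilter s X → (∀ Y → at (flip s) Y → X ≬ Y) → at s X

  open Elem

  module _ {I : Set₁} (g : I → Subset) where

    -- The filters of the opposite sign that have a member in common with every g i, and the
    -- s-filters that have one with all of those.
    Polar : Sign → Subset → Set₁
    Polar s Y = IsFilter (flip s) Y × (∀ i → g i ≬ Y)

    Bipolar : Sign → Subset → Set₁
    Bipolar s X = IsFilter s X × (∀ Y → Polar s Y → X ≬ Y)

    generator-bipolar : ∀ s → (∀ i → IsFilter s (g i)) → ∀ i → Bipolar s (g i)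
    generator-bipolar s filters i = filters i , λ Y polar → proj₂ polar i

    -- The join, in the order of sign s, of the elements represented by a family of
    -- s-filters.
    generated : ∀ s → (∀ i → IsFilter s (g i)) → Elem
    generated 𝟏 filters = record
      { at       = λ { 𝟏 → Bipolar 𝟏 ; ∂ → Polar 𝟏 }
      ; isFilter = λ { 𝟏 → proj₁ ; ∂ → proj₁ }
      ; sound    = λ { 𝟏 x y → proj₂ x _ y ; ∂ y x → ≬-sym (proj₂ x _ y) }
      ; stable   = λ { 𝟏 fX meets → fX , meets
                     ; ∂ fY meets → fY , λ i → ≬-sym (meets _ (generator-bipolar 𝟏 filters i)) } }
    generated ∂ filters = record
      { at       = λ { 𝟏 → Polar ∂ ; ∂ → Bipolar ∂ }
      ; isFilter = λ { 𝟏 → proj₁ ; ∂ → proj₁ }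
      ; sound    = λ { 𝟏 y x → ≬-sym (proj₂ x _ y) ; ∂ x y → proj₂ x _ y }
      ; stable   = λ { 𝟏 fY meets → fY , λ i → ≬-sym (meets _ (generator-bipolar ∂ filters i))
                     ; ∂ fX meets → fX , meets } }

    generator-at : ∀ s (filters : ∀ i → IsFilter s (g i)) i → at (generated s filters) s (g i)
    generator-at 𝟏 = generator-bipolar 𝟏
    generator-at ∂ = generator-bipolar ∂

    generated-polar : ∀ s (filters : ∀ i → IsFilter s (g i)) {Y} →
      at (generated s filters) (flip s) Y ⇔ Polar s Y
    generated-polar 𝟏 filters = mk⇔ id id
    generated-polar ∂ filters = mk⇔ id id

  infix 4 _⊑[_]_

  -- The order of the extension, read in the direction of sign s. Having a common member
  -- with every upper open element amounts to inclusion of the sets at s.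
  record _⊑[_]_ (a : Elem) (s : Sign) (b : Elem) : Set₁ where
    constructor by-common
    field
      common : ∀ X Y → at a s X → at b (flip s) Y → X ≬ Y

  open _⊑[_]_

  ⊑-refl : ∀ s {a} → a ⊑[ s ] a
  ⊑-refl s {a} = by-common λ X Y → sound a s

  ⊑-at : ∀ s {a b X} → a ⊑[ s ] b → at a s X → at b s X
  ⊑-at s {a} {b} a⊑b x = stable b s (isFilter a s x) λ Y → common a⊑b _ Y x

  ⊑-trans : ∀ s {a b c} → a ⊑[ s ] b → b ⊑[ s ] c → a ⊑[ s ] c
  ⊑-trans s a⊑b b⊑c = by-common λ X Y x → common b⊑c X Y (⊑-at s a⊑b x)

  ⊑-dual : ∀ s {a b} → a ⊑[ s ] b ⇔ b ⊑[ flip s ] a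
  ⊑-dual 𝟏 = mk⇔ (λ p → by-common λ X Y x y → ≬-sym (common p Y X y x))
                 (λ p → by-common λ X Y x y → ≬-sym (common p Y X y x))
  ⊑-dual ∂ = mk⇔ (λ p → by-common λ X Y x y → ≬-sym (common p Y X y x))
                 (λ p → by-common λ X Y x y → ≬-sym (common p Y X y x))

  module _ {I : Set₁} (g : I → Subset) where

    generated-⊑ : ∀ s (filters : ∀ i → IsFilter s (g i)) {b} →
      generated g s filters ⊑[ s ] b ⇔ (∀ i Y → at b (flip s) Y → g i ≬ Y)
    generated-⊑ s filters {b} = mk⇔
      (λ p i Y y → common p (g i) Y (generator-at g s filters i) y)
      (λ p → by-common λ X Y x y → sound (generated g s filters) s x
        (from (generated-polar g s filters) (isFilter b (flip s) y , λ i → p i Y y)))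

    ⊑-generated : ∀ s (filters : ∀ i → IsFilter (flip s) (g i)) {a} →
      a ⊑[ s ] generated g (flip s) filters ⇔ (∀ i X → at a s X → g i ≬ X)
    ⊑-generated s filters {a} = mk⇔
      (λ p i X x → to (generated-⊑ (flip s) filters) (to (⊑-dual s) p) i X
        (transport (λ t → at a t X) (sym (flip-flip s)) x))
      (λ p → from (⊑-dual s) (from (generated-⊑ (flip s) filters)
        λ i X x → p i X (transport (λ t → at a t X) (flip-flip s) x)))

  -- Normal operators and their residuals on the canonical extension

  -- An n-ary operator that turns finite joins of sign lookup τ i in its i-th argument into
  -- finite joins of sign s. A connective in F with order-type η has s = 𝟏 and
  -- τ = η; one in G has s = ∂ and τ opposite to η.
  record NormalOp (s : Sign) {n : ℕ} (τ : Vec Sign n) : Set where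
    field
      fun  : Vec Carrier n → Carrier
      mon  : ∀ i as {x y} → x ≤[ lookup τ i ] y → fun (as [ i ]≔ x) ≤[ s ] fun (as [ i ]≔ y)
      fun-bot  : ∀ i as → fun (as [ i ]≔ bot (lookup τ i)) ≤[ s ] bot s
      fun-join : ∀ i as x y → fun (as [ i ]≔ join (lookup τ i) x y) ≤[ s ]
                              join s (fun (as [ i ]≔ x)) (fun (as [ i ]≔ y))

  module Extension {s : Sign} {n : ℕ} {τ : Vec Sign n} (h : NormalOp s τ) where

    open NormalOp h

    -- Coordinatewise relations, each read in the sign of its coordinate.

    Below : Fin n → Carrier → Carrier → Set
    Below i x y = x ≤[ lookup τ i ] y

    Member : Fin n → Carrier → Subset → Set
    Member i x X = X x

    Point : Fin n → Subset → Elem → Set₁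
    Point i X a = at a (lookup τ i) X

    fun-mono : ∀ {as bs} → Everywhere Below as bs → fun as ≤[ s ] fun bs
    fun-mono = monotone-everywhere _≤[ s ]_ (≤-refl s) (≤-trans s) Below fun mon

    meets : Vec Carrier n → Vec Carrier n → Vec Carrier n
    meets as bs = tabulate λ i → meet (lookup τ i) (lookup as i) (lookup bs i)

    meets-≤₁ : ∀ as bs → Everywhere Below (meets as bs) as
    meets-≤₁ as bs i = transport (λ z → Below i z (lookup as i))
      (sym (lookup∘tabulate _ i)) (meet-≤₁ (lookup τ i) _ _)

    meets-≤₂ : ∀ as bs → Everywhere Below (meets as bs) bs
    meets-≤₂ as bs i = transport (λ z → Below i z (lookup bs i))
      (sym (lookup∘tabulate _ i)) (meet-≤₂ (lookup τ i) _ _)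

    tops : Vec Carrier n
    tops = tabulate λ i → top (lookup τ i)

    tops-member : ∀ {i X} → IsFilter (lookup τ i) X → X (lookup tops i)
    tops-member {i} {X} fX = transport X (sym (lookup∘tabulate _ i)) (∋top fX)

    meets-member : ∀ as bs {i X} → IsFilter (lookup τ i) X → X (lookup as i) →
                   X (lookup bs i) → X (lookup (meets as bs) i)
    meets-member as bs {i} {X} fX a b =
      transport X (sym (lookup∘tabulate _ i)) (∋meet fX a b)

    -- The s-filter generated by the values of h on members of the given filters.
    image : Vec Subset n → Subset
    image Xs y = ∃ λ as → Everywhere Member as Xs × fun as ≤[ s ] y

    image-isFilter : ∀ Xs → (∀ i → IsFilter (lookup τ i) (lookup Xs i)) →
                     IsFilter s (image Xs)
    image-isFilter Xs filters = record
      { up    = λ { y≤z (as , mem , p) → as , mem , ≤-trans s p y≤z }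
      ; ∋top  = tops , (λ i → tops-member (filters i)) , ≤-top s _
      ; ∋meet = λ { (as , mem , p) (bs , mem′ , q) →
          meets as bs , (λ i → meets-member as bs (filters i) (mem i) (mem′ i)) ,
          meet-greatest s (≤-trans s (fun-mono (meets-≤₁ as bs)) p)
                          (≤-trans s (fun-mono (meets-≤₂ as bs)) q) } }

    -- The arguments in coordinate i for which h, with members of the given filters in the
    -- other coordinates, takes a value in Y. The entry of Xs in coordinate i is ignored.
    preimage : Fin n → Vec Subset n → Subset → Subset
    preimage i Xs Y x = ∃ λ as → AwayFrom Member i as Xs × Y (fun (as [ i ]≔ x))

    -- This is where preservation of finite joins is used.
    preimage-isFilter : ∀ i Xs Y →
      (∀ j → j ≢ i → IsFilter (lookup τ j) (lookup Xs j)) → IsFilter (flip s) Y →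
      IsFilter (flip (lookup τ i)) (preimage i Xs Y)
    preimage-isFilter i Xs Y filters fY = record
      { up    = λ { x≤y (as , mem , p) →
          as , mem , up fY (≤-dual s (mon i as (≤-undual (lookup τ i) x≤y))) p }
      ; ∋top  = tops , (λ j j≢i → tops-member (filters j j≢i)) ,
          up fY (≤-dual s (fun-bot i tops)) (∋top fY)
      ; ∋meet = λ { (as , mem , p) (bs , mem′ , q) →
          let cs = meets as bs in
          cs , (λ j j≢i → meets-member as bs (filters j j≢i) (mem j j≢i) (mem′ j j≢i)) ,
          up fY (≤-dual s (fun-join i cs _ _))
            (∋meet fY (up fY (≤-dual s (replace (meets-≤₁ as bs))) p)
                      (up fY (≤-dual s (replace (meets-≤₂ as bs))) q)) } }
      where
      replace : ∀ {as bs x} → Everywhere Below as bs → fun (as [ i ]≔ x) ≤[ s ] fun (bs [ i ]≔ x)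
      replace {as} {bs} below = fun-mono (fill Below i as bs (λ j _ → below j) (≤-refl (lookup τ i)))

    -- Both sides say that h takes a value in Y on members of the given filters and of X.
    image-≬ : ∀ i Xs {X Y} → IsFilter (flip s) Y →
              image (Xs [ i ]≔ X) ≬ Y ⇔ preimage i Xs Y ≬ X
    image-≬ i Xs {X} {Y} fY = mk⇔
      (λ { (y , (as , mem , p) , q) →
         lookup as i ,
         (as , away-restore Member i as Xs (λ j _ → mem j) ,
          transport (Y ∘ fun) (sym ([]≔-lookup as i)) (up fY (≤-dual s p) q)) ,
         at-updated Member i as Xs mem })
      (λ { (x , (as , mem , q) , p) →
         fun (as [ i ]≔ x) , (as [ i ]≔ x , fill Member i as Xs mem p , ≤-refl s) , q })

    module _ (es : Vec Elem n) where

      PointOf : Set₁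
      PointOf = ∃ λ Xs → Everywhere Point Xs es

      imageAt : PointOf → Subset
      imageAt (Xs , _) = image Xs

      imageAt-isFilter : ∀ p → IsFilter s (imageAt p)
      imageAt-isFilter (Xs , pts) = image-isFilter Xs λ i → isFilter (lookup es i) _ (pts i)

      -- The canonical extension of h.
      extension : Elem
      extension = generated imageAt s imageAt-isFilter

      extension-at : ∀ Y → at extension (flip s) Y ⇔ Polar imageAt s Y
      extension-at Y = generated-polar imageAt s imageAt-isFilter

      extension-⊑ : ∀ {b} → extension ⊑[ s ] b ⇔
        (∀ p Y → at b (flip s) Y → imageAt p ≬ Y)
      extension-⊑ = generated-⊑ imageAt s imageAt-isFilter

    module _ (i : Fin n) (es : Vec Elem n) where

      CopointOf : Set₁
      CopointOf = ∃ λ Xs → ∃ λ Y → AwayFrom Point i Xs es × at (lookup es i) (flip s) Y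

      preimageAt : CopointOf → Subset
      preimageAt (Xs , Y , _) = preimage i Xs Y

      preimageAt-isFilter : ∀ p → IsFilter (flip (lookup τ i)) (preimageAt p)
      preimageAt-isFilter (Xs , Y , pts , y) = preimage-isFilter i Xs Y
        (λ j j≢i → isFilter (lookup es j) _ (pts j j≢i)) (isFilter (lookup es i) _ y)

      -- The residual of the extension in coordinate i. The i-th entry of the vector is the
      -- bound on the value; the other entries are the remaining arguments of h.
      residualExt : Elem
      residualExt = generated preimageAt (flip (lookup τ i)) preimageAt-isFilter

      ⊑-residualExt : ∀ {a} → a ⊑[ lookup τ i ] residualExt ⇔
        (∀ p X → at a (lookup τ i) X → preimageAt p ≬ X)
      ⊑-residualExt = ⊑-generated preimageAt (lookup τ i) preimageAt-isFilter

    residuation : ∀ i es a b →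
      extension (es [ i ]≔ a) ⊑[ s ] b ⇔ a ⊑[ lookup τ i ] residualExt i (es [ i ]≔ b)
    residuation i es a b = mk⇔
      (λ p → from (⊑-residualExt i (es [ i ]≔ b)) λ { (Xs , Y , pts , y) X x →
        let y′ = transport (λ c → at c (flip s) Y) (lookup∘update i es b) y in
        to (image-≬ i Xs (isFilter b (flip s) y′))
          (to (extension-⊑ (es [ i ]≔ a)) p
            (Xs [ i ]≔ X , fill Point i Xs es (away-restore Point i Xs es pts) x) Y y′) })
      (λ q → from (extension-⊑ (es [ i ]≔ a)) λ { (Xs , pts) Y y →
        let y′ = transport (λ c → at c (flip s) Y) (sym (lookup∘update i es b)) y in
        transport (λ Zs → image Zs ≬ Y) ([]≔-lookup Xs i)
          (from (image-≬ i Xs (isFilter b (flip s) y))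
            (to (⊑-residualExt i (es [ i ]≔ b)) q
              (Xs , Y ,
               away-update Point i Xs es (away-restore Point i Xs es λ j _ → pts j) , y′)
              (lookup Xs i) (at-updated Point i Xs es pts))) })

  -- A map which, from the order of sign t to that of sign s, has a right adjoint.
  record Adjoint (s t : Sign) (o : Elem → Elem) : Set₂ where
    constructor adjoint
    field
      right      : Elem → Elem
      adjunction : ∀ a b → o a ⊑[ s ] b ⇔ a ⊑[ t ] right b

  open Adjoint

  module _ {s : Sign} {n : ℕ} {τ : Vec Sign n} (h : NormalOp s τ) where

    open Extension h using (extension; residualExt; residuation)

    extension-adjoint : ∀ i es → Adjoint s (lookup τ i) λ a → extension (es [ i ]≔ a)
    extension-adjoint i es = adjoint (λ b → residualExt i (es [ i ]≔ b)) (residuation i es)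

    -- In coordinate i the adjoint is the extension of h itself; in another coordinate k
    -- it is the residual of h in coordinate k.
    residualExt-adjoint : ∀ i k es →
      Adjoint (flip (lookup τ i)) (lookup (τ [ i ]≔ flip s) k) λ a → residualExt i (es [ k ]≔ a)
    residualExt-adjoint i k es with k ≟ i
    ... | yes refl = transport (λ t → Adjoint (flip (lookup τ i)) t λ a → residualExt i (es [ i ]≔ a))
      (sym (lookup∘update i τ (flip s)))
      (adjoint (λ b → extension (es [ i ]≔ b)) λ a b →
        ⊑-dual s ⇔-∘ (⇔-sym (residuation i es b a) ⇔-∘ ⇔-sym (⊑-dual (lookup τ i))))
    ... | no k≢i = transport (λ t → Adjoint (flip (lookup τ i)) t λ a → residualExt i (es [ k ]≔ a))
      (sym (lookup∘update′ k≢i τ (flip s)))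
      (adjoint (λ b → residualExt k ((es [ i ]≔ b) [ k ]≔ e)) λ a b →
        residuation k (es [ i ]≔ b) a e ⇔-∘ (exchange a b ⇔-∘ ⇔-sym (⊑-dual (lookup τ i))))
      where
      e : Elem
      e = lookup es i

      unchanged : ∀ a → (es [ k ]≔ a) [ i ]≔ e ≡ es [ k ]≔ a
      unchanged a = trans
        (cong ((es [ k ]≔ a) [ i ]≔_) (sym (lookup∘update′ (λ i≡k → k≢i (sym i≡k)) es a)))
        ([]≔-lookup (es [ k ]≔ a) i)

      exchange : ∀ a b → b ⊑[ lookup τ i ] residualExt i (es [ k ]≔ a) ⇔
                         extension ((es [ i ]≔ b) [ k ]≔ a) ⊑[ s ] e
      exchange a b = subst₂
        (λ γ δ → b ⊑[ lookup τ i ] residualExt i γ ⇔ extension δ ⊑[ s ] e)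
        (unchanged a) ([]≔-commutes es k i k≢i)
        (⇔-sym (residuation i (es [ k ]≔ a) b e))

  -- Lattice operations and embedding of the lattice

  meet-mono : ∀ s {x x′ y y′} → x ≤[ s ] x′ → y ≤[ s ] y′ → meet s x y ≤[ s ] meet s x′ y′
  meet-mono s p q = meet-greatest s (≤-trans s (meet-≤₁ s _ _) p) (≤-trans s (meet-≤₂ s _ _) q)

  meetOp : ∀ s → NormalOp s (s ∷ s ∷ [])
  meetOp s = record
    { fun = λ { (x ∷ y ∷ []) → meet s x y }
    ; mon = λ { zero (x ∷ y ∷ []) p → meet-mono s p (≤-refl s)
              ; (suc zero) (x ∷ y ∷ []) p → meet-mono s (≤-refl s) p }
    ; fun-bot = λ { zero (x ∷ y ∷ []) → meet-≤₁ s _ _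
                  ; (suc zero) (x ∷ y ∷ []) → meet-≤₂ s _ _ }
    ; fun-join = λ { zero (x ∷ y ∷ []) → meet-distribʳ s y
                   ; (suc zero) (x ∷ y ∷ []) → meet-distribˡ s x } }

  -- The extension of the meet. It is shown below to be the meet in the extension.
  meetₑ : Sign → Op₂ Elem
  meetₑ s a b = Extension.extension (meetOp s) (a ∷ b ∷ [])

  joinₑ : Sign → Op₂ Elem
  joinₑ s = meetₑ (flip s)

  -- If z is common to the first filter and to Y, it also lies in the generated filter, being
  -- above its own meet with top s, which belongs to the second filter.
  meetₑ-⊑₁ : ∀ s a b → meetₑ s a b ⊑[ s ] a
  meetₑ-⊑₁ s a b = from (Extension.extension-⊑ (meetOp s) (a ∷ b ∷ [])) λ { (X₁ ∷ X₂ ∷ [] , pts) Y y →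
    let (z , z∈X₁ , z∈Y) = sound a s (pts zero) y in
    z , (z ∷ top s ∷ [] ,
         (λ { zero → z∈X₁ ; (suc zero) → ∋top (isFilter b s (pts (suc zero))) }) ,
         meet-≤₁ s z (top s)) , z∈Y }

  meetₑ-⊑₂ : ∀ s a b → meetₑ s a b ⊑[ s ] b
  meetₑ-⊑₂ s a b = from (Extension.extension-⊑ (meetOp s) (a ∷ b ∷ [])) λ { (X₁ ∷ X₂ ∷ [] , pts) Y y →
    let (z , z∈X₂ , z∈Y) = sound b s (pts (suc zero)) y in
    z , (top s ∷ z ∷ [] ,
         (λ { zero → ∋top (isFilter a s (pts zero)) ; (suc zero) → z∈X₂ }) ,
         meet-≤₂ s (top s) z) , z∈Y }

  -- The two arguments of the meet are taken in the same filter X, which contains their meet.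
  meetₑ-greatest : ∀ s {a b c} → c ⊑[ s ] a → c ⊑[ s ] b → c ⊑[ s ] meetₑ s a b
  meetₑ-greatest s {a} {b} {c} c⊑a c⊑b = by-common λ X Y x y →
    let fX = isFilter c s x
        (w , image , w∈Y) =
          proj₂ (to (Extension.extension-at (meetOp s) (a ∷ b ∷ []) Y) y)
            (X ∷ X ∷ [] , λ { zero → ⊑-at s c⊑a x ; (suc zero) → ⊑-at s c⊑b x })
    in w , in-filter fX image , w∈Y
    where
    in-filter : ∀ {X} → IsFilter s X → ∀ {w} → Extension.image (meetOp s) (X ∷ X ∷ []) w → X w
    in-filter fX (z₁ ∷ z₂ ∷ [] , mem , p) = up fX p (∋meet fX (mem zero) (mem (suc zero)))

  ⊑-joinₑ₁ : ∀ s a b → a ⊑[ s ] joinₑ s a b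
  ⊑-joinₑ₁ s a b = from (⊑-dual s) (meetₑ-⊑₁ (flip s) a b)

  ⊑-joinₑ₂ : ∀ s a b → b ⊑[ s ] joinₑ s a b
  ⊑-joinₑ₂ s a b = from (⊑-dual s) (meetₑ-⊑₂ (flip s) a b)

  joinₑ-least : ∀ s {a b c} → a ⊑[ s ] c → b ⊑[ s ] c → joinₑ s a b ⊑[ s ] c
  joinₑ-least s p q = from (⊑-dual s) (meetₑ-greatest (flip s) (to (⊑-dual s) p) (to (⊑-dual s) q))

  -- The element x of the lattice, seen in the canonical extension.
  ⌈_⌉ : Carrier → Elem
  ⌈ x ⌉ = record
    { at       = λ s X → Lift (ℓsuc 0ℓ) (IsFilter s X × X x)
    ; isFilter = λ { s (lift (fX , _)) → fX }
    ; sound    = λ { s (lift (_ , x∈X)) (lift (_ , x∈Y)) → x , x∈X , x∈Y }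
    ; stable   = λ s fX meets →
        let (y , y∈X , x≤y) = meets (principal (flip s) x)
              (lift (principal-isFilter (flip s) x , ≤-refl (flip s)))
        in lift (fX , up fX (≤-undual s x≤y) y∈X) }

  ⊑-top : ∀ s {a} → a ⊑[ s ] ⌈ top s ⌉
  ⊑-top s {a} = by-common λ { X Y x (lift (_ , top∈Y)) →
    top s , ∋top (isFilter a s x) , top∈Y }

  bot-⊑ : ∀ s {a} → ⌈ bot s ⌉ ⊑[ s ] a
  bot-⊑ s = from (⊑-dual s) (⊑-top (flip s))

  -- The element a is x, seen in the extension. Stated through membership, since elements of the
  -- extension are compared only by ⊑.
  Represents : Elem → Carrier → Set₁
  Represents a x = ∀ s X → IsFilter s X → at a s X ⇔ X x

  ⌈⌉-represents : ∀ x → Represents ⌈ x ⌉ x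
  ⌈⌉-represents x s X fX = mk⇔ (proj₂ ∘ lower) λ x∈X → lift (fX , x∈X)

  represents-⊑ : ∀ {a b} x y → Represents a x → Represents b y → a ⊑[ 𝟏 ] b → x A.≤ y
  represents-⊑ x y ra rb a⊑b =
    let (z , x≤z , z≤y) = common a⊑b _ _
          (from (ra 𝟏 _ (principal-isFilter 𝟏 x)) (≤-refl 𝟏))
          (from (rb ∂ _ (principal-isFilter ∂ y)) (≤-refl ∂))
    in ≤-trans 𝟏 x≤z z≤y

  -- One of the two polar sets determines the other.
  represents : ∀ s {a x} →
    (∀ Y → IsFilter (flip s) Y → at a (flip s) Y ⇔ Y x) → Represents a x
  represents s {a} {x} polar = by-cases s polar below
    where
    below : ∀ X → IsFilter s X → at a s X ⇔ X x
    below X fX = mk⇔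
      (λ p → let (z , z∈X , x≤z) = sound a s p
                   (from (polar _ (principal-isFilter (flip s) x)) (≤-refl (flip s)))
             in up fX (≤-undual s x≤z) z∈X)
      (λ x∈X → stable a s fX λ Y p → x , x∈X , to (polar Y (isFilter a (flip s) p)) p)

    by-cases : ∀ s → (∀ Y → IsFilter (flip s) Y → at a (flip s) Y ⇔ Y x) →
               (∀ X → IsFilter s X → at a s X ⇔ X x) → Represents a x
    by-cases 𝟏 q p 𝟏 = p
    by-cases 𝟏 q p ∂ = q
    by-cases ∂ q p 𝟏 = q
    by-cases ∂ q p ∂ = p

  extension-represents : ∀ {s n} {τ : Vec Sign n} (h : NormalOp s τ) es as →
    (∀ i → Represents (lookup es i) (lookup as i)) →
    Represents (Extension.extension h es) (NormalOp.fun h as)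
  extension-represents {s} {n} {τ} h es as rep =
    represents s {Extension.extension h es} λ Y fY → mk⇔
      (λ y → let (z , (bs , mem , p) , z∈Y) =
                   proj₂ (to (extension-at es Y) y) (principals , principals-at)
             in up fY (≤-dual s (≤-trans s
                  (fun-mono (principals-below bs mem)) p)) z∈Y)
      (λ h∈Y → from (extension-at es Y) (fY , λ { (Xs , pts) →
        fun as ,
        (as , (λ i → to (rep i (lookup τ i) _ (isFilter (lookup es i) _ (pts i))) (pts i)) ,
         ≤-refl s) , h∈Y }))
    where
    open Extension h
    open NormalOp h

    principals : Vec Subset n
    principals = tabulate λ i → principal (lookup τ i) (lookup as i)

    principals-below : ∀ bs → Everywhere Member bs principals → Everywhere Below as bs
    principals-below bs mem i = transport (λ X → X (lookup bs i))
      (lookup∘tabulate (λ j → principal (lookup τ j) (lookup as j)) i) (mem i)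

    principals-at : ∀ i → at (lookup es i) (lookup τ i) (lookup principals i)
    principals-at i = transport (at (lookup es i) (lookup τ i)) (sym (lookup∘tabulate _ i))
      (from (rep i (lookup τ i) _ (principal-isFilter _ _)) (≤-refl (lookup τ i)))

  -- A map with a right adjoint is monotone and preserves finite joins.

  module _ {s t : Sign} {o : Elem → Elem} (adj : Adjoint s t o) where

    adjoint-mono : ∀ {a b} → a ⊑[ t ] b → o a ⊑[ s ] o b
    adjoint-mono {a} {b} a⊑b =
      from (adjunction adj a (o b)) (⊑-trans t a⊑b (to (adjunction adj b (o b)) (⊑-refl s)))

    adjoint-bot : o ⌈ bot t ⌉ ⊑[ s ] ⌈ bot s ⌉
    adjoint-bot = from (adjunction adj _ _) (bot-⊑ t)

    adjoint-join : ∀ a b → o (joinₑ t a b) ⊑[ s ] joinₑ s (o a) (o b)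
    adjoint-join a b = from (adjunction adj _ _) (joinₑ-least t
      (to (adjunction adj a _) (⊑-joinₑ₁ s _ _)) (to (adjunction adj b _) (⊑-joinₑ₂ s _ _)))

-- The Lindenbaum algebra

subs-update : ∀ {L n} σ (γ : Vec (Formula L) n) i χ →
              subs σ (γ [ i ]≔ χ) ≡ subs σ γ [ i ]≔ sub σ χ
subs-update σ (φ ∷ γ) zero    χ = refl
subs-update σ (φ ∷ γ) (suc i) χ = cong (sub σ φ ∷_) (subs-update σ γ i χ)

module Schematic {L : DLELanguage} {Rule : Sequent L → Sequent L → Set} where

  infix 3 ⊩_

  ⊩_ : Sequent L → Set
  ⊩_ = Derivable Rule

  -- The substitution of three formulas for the variables 0, 1 and 2.
  assign : Formula L → Formula L → Formula L → ℕ → Formula L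
  assign φ ψ χ 0                 = φ
  assign φ ψ χ 1                 = ψ
  assign φ ψ χ (ℕ.suc (ℕ.suc _)) = χ

  ⊩-refl : ∀ {φ} → ⊩ φ ⊢ φ
  ⊩-refl {φ} = subst (assign φ φ φ) (ax 0)

  ⊥-least : ∀ φ → ⊩ ⊥ ⊢ φ
  ⊥-least φ = subst (assign φ φ φ) (ax-⊥ 0)

  ⊤-greatest : ∀ φ → ⊩ φ ⊢ ⊤
  ⊤-greatest φ = subst (assign φ φ φ) (ax-⊤ 0)

  ∨-upper₁ : ∀ φ ψ → ⊩ φ ⊢ φ ∨ ψ
  ∨-upper₁ φ ψ = subst (assign φ ψ ψ) (ax-∨₁ 0 1)

  ∨-upper₂ : ∀ φ ψ → ⊩ ψ ⊢ φ ∨ ψ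
  ∨-upper₂ φ ψ = subst (assign φ ψ ψ) (ax-∨₂ 0 1)

  ∧-lower₁ : ∀ φ ψ → ⊩ φ ∧ ψ ⊢ φ
  ∧-lower₁ φ ψ = subst (assign φ ψ ψ) (ax-∧₁ 0 1)

  ∧-lower₂ : ∀ φ ψ → ⊩ φ ∧ ψ ⊢ ψ
  ∧-lower₂ φ ψ = subst (assign φ ψ ψ) (ax-∧₂ 0 1)

  ∧-distribˡ : ∀ φ ψ χ → ⊩ φ ∧ (ψ ∨ χ) ⊢ (φ ∧ ψ) ∨ (φ ∧ χ)
  ∧-distribˡ φ ψ χ = subst (assign φ ψ χ) (distrib 0 1 2)

  ∧-distribˡ⁻¹ : ∀ φ ψ χ → ⊩ (φ ∧ ψ) ∨ (φ ∧ χ) ⊢ φ ∧ (ψ ∨ χ)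
  ∧-distribˡ⁻¹ φ ψ χ = ∨-elim
    (∧-intro (∧-lower₁ φ ψ) (cut (∧-lower₂ φ ψ) (∨-upper₁ ψ χ)))
    (∧-intro (∧-lower₁ φ χ) (cut (∧-lower₂ φ χ) (∨-upper₂ ψ χ)))

  -- The axioms for connectives hold with arbitrary formulas in place of p and q and the
  -- parameters unchanged: take p = 0 and q = 1, shift the variables of the parameters away
  -- from them, and shift them back in the instantiating substitution.

  shift : ℕ → Formula L
  shift p = var (ℕ.suc (ℕ.suc p))

  inst : Formula L → Formula L → ℕ → Formula L
  inst φ ψ 0                 = φ
  inst φ ψ 1                 = ψ
  inst φ ψ (ℕ.suc (ℕ.suc p)) = var p

  module _ (φ ψ : Formula L) where

    inst-shift  : ∀ χ → sub (inst φ ψ) (sub shift χ) ≡ χ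
    insts-shift : ∀ {n} (γ : Vec (Formula L) n) → subs (inst φ ψ) (subs shift γ) ≡ γ
    inst-shift (var p)  = refl
    inst-shift ⊥        = refl
    inst-shift ⊤        = refl
    inst-shift (χ ∧ ξ)  = cong₂ _∧_ (inst-shift χ) (inst-shift ξ)
    inst-shift (χ ∨ ξ)  = cong₂ _∨_ (inst-shift χ) (inst-shift ξ)
    inst-shift (op h γ) = cong (op h) (insts-shift γ)
    insts-shift []      = refl
    insts-shift (χ ∷ γ) = cong₂ _∷_ (inst-shift χ) (insts-shift γ)

    instantiate : ∀ h γ i χ → sub (inst φ ψ) (h ⟨ subs shift γ ⟩[ i ≔ χ ]) ≡
                              h ⟨ γ ⟩[ i ≔ sub (inst φ ψ) χ ]
    instantiate h γ i χ = cong (op h) (trans (subs-update (inst φ ψ) (subs shift γ) i χ)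
      (cong (_[ i ]≔ sub (inst φ ψ) χ) (insts-shift γ)))

    f-∨-schema : ∀ f γ i → ε L (inj₁ f) i ≡ 𝟏 →
      ⊩ inj₁ f ⟨ γ ⟩[ i ≔ φ ∨ ψ ] ⊢ inj₁ f ⟨ γ ⟩[ i ≔ φ ] ∨ inj₁ f ⟨ γ ⟩[ i ≔ ψ ]
    f-∨-schema f γ i e = subst₂ (λ α β → ⊩ α ⊢ β) (instantiate _ γ i _)
      (cong₂ _∨_ (instantiate _ γ i _) (instantiate _ γ i _))
      (subst (inst φ ψ) (f-∨ f (subs shift γ) i e 0 1))

    f-∧-schema : ∀ f γ i → ε L (inj₁ f) i ≡ ∂ →
      ⊩ inj₁ f ⟨ γ ⟩[ i ≔ φ ∧ ψ ] ⊢ inj₁ f ⟨ γ ⟩[ i ≔ φ ] ∨ inj₁ f ⟨ γ ⟩[ i ≔ ψ ]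
    f-∧-schema f γ i e = subst₂ (λ α β → ⊩ α ⊢ β) (instantiate _ γ i _)
      (cong₂ _∨_ (instantiate _ γ i _) (instantiate _ γ i _))
      (subst (inst φ ψ) (f-∧ f (subs shift γ) i e 0 1))

    g-∧-schema : ∀ g γ j → ε L (inj₂ g) j ≡ 𝟏 →
      ⊩ inj₂ g ⟨ γ ⟩[ j ≔ φ ] ∧ inj₂ g ⟨ γ ⟩[ j ≔ ψ ] ⊢ inj₂ g ⟨ γ ⟩[ j ≔ φ ∧ ψ ]
    g-∧-schema g γ j e = subst₂ (λ α β → ⊩ α ⊢ β)
      (cong₂ _∧_ (instantiate _ γ j _) (instantiate _ γ j _)) (instantiate _ γ j _)
      (subst (inst φ ψ) (g-∧ g (subs shift γ) j e 0 1))

    g-∨-schema : ∀ g γ j → ε L (inj₂ g) j ≡ ∂ →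
      ⊩ inj₂ g ⟨ γ ⟩[ j ≔ φ ] ∧ inj₂ g ⟨ γ ⟩[ j ≔ ψ ] ⊢ inj₂ g ⟨ γ ⟩[ j ≔ φ ∨ ψ ]
    g-∨-schema g γ j e = subst₂ (λ α β → ⊩ α ⊢ β)
      (cong₂ _∧_ (instantiate _ γ j _) (instantiate _ γ j _)) (instantiate _ γ j _)
      (subst (inst φ ψ) (g-∨ g (subs shift γ) j e 0 1))

-- The sign in which a connective is normal: the values of those in F are joined, the
-- values of those in G are met.
signOf : ∀ {A B : Set} → A ⊎ B → Sign
signOf (inj₁ _) = 𝟏
signOf (inj₂ _) = ∂

module Semantics (L : DLELanguage) where

  open Schematic {L} {Never}

  -- Formulas ordered by derivability, with interderivability as equality.
  lindenbaum : BoundedLattice 0ℓ 0ℓ 0ℓ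
  lindenbaum = record
    { Carrier = Formula L
    ; _≈_ = λ φ ψ → 𝐋 L (φ ⊢ ψ) × 𝐋 L (ψ ⊢ φ)
    ; _≤_ = λ φ ψ → 𝐋 L (φ ⊢ ψ)
    ; _∨_ = _∨_ ; _∧_ = _∧_ ; ⊤ = ⊤ ; ⊥ = ⊥
    ; isBoundedLattice = record
      { isLattice = record
        { isPartialOrder = record
          { isPreorder = record
            { isEquivalence = record
              { refl  = ⊩-refl , ⊩-refl
              ; sym   = λ (p , q) → q , p
              ; trans = λ (p , q) (p′ , q′) → cut p p′ , cut q′ q }
            ; reflexive = proj₁
            ; trans = cut }
          ; antisym = _,_ }
        ; supremum = λ φ ψ → ∨-upper₁ φ ψ , ∨-upper₂ φ ψ , λ χ → ∨-elim
        ; infimum  = λ φ ψ → ∧-lower₁ φ ψ , ∧-lower₂ φ ψ , λ χ → ∧-intro }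
      ; maximum = ⊤-greatest
      ; minimum = ⊥-least } }

  open CanonicalExtension lindenbaum
    (λ φ ψ χ → ∧-distribˡ φ ψ χ , ∧-distribˡ⁻¹ φ ψ χ)

  connective-mono : ∀ h γ i {t φ ψ} → ε L h i ≡ t → φ ≤[ signOf h · t ] ψ →
    h ⟨ γ ⟩[ i ≔ φ ] ≤[ signOf h ] h ⟨ γ ⟩[ i ≔ ψ ]
  connective-mono (inj₁ f) γ i {𝟏} e p = mono (inj₁ f) γ i e p
  connective-mono (inj₁ f) γ i {∂} e p = anti (inj₁ f) γ i e p
  connective-mono (inj₂ g) γ i {𝟏} e p = mono (inj₂ g) γ i e p
  connective-mono (inj₂ g) γ i {∂} e p = anti (inj₂ g) γ i e p

  connective-bot : ∀ h γ i {t} → ε L h i ≡ t →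
    h ⟨ γ ⟩[ i ≔ bot (signOf h · t) ] ≤[ signOf h ] bot (signOf h)
  connective-bot (inj₁ f) γ i {𝟏} = f-⊥ f γ i
  connective-bot (inj₁ f) γ i {∂} = f-⊤ f γ i
  connective-bot (inj₂ g) γ i {𝟏} = g-⊤ g γ i
  connective-bot (inj₂ g) γ i {∂} = g-⊥ g γ i

  connective-join : ∀ h γ i φ ψ {t} → ε L h i ≡ t →
    h ⟨ γ ⟩[ i ≔ join (signOf h · t) φ ψ ] ≤[ signOf h ]
    join (signOf h) (h ⟨ γ ⟩[ i ≔ φ ]) (h ⟨ γ ⟩[ i ≔ ψ ])
  connective-join (inj₁ f) γ i φ ψ {𝟏} = f-∨-schema φ ψ f γ i
  connective-join (inj₁ f) γ i φ ψ {∂} = f-∧-schema φ ψ f γ i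
  connective-join (inj₂ g) γ i φ ψ {𝟏} = g-∧-schema φ ψ g γ i
  connective-join (inj₂ g) γ i φ ψ {∂} = g-∨-schema φ ψ g γ i

  -- The connective h as a normal operator on the Lindenbaum algebra. The sign of each
  -- coordinate is that of the order-type for h in F and the opposite one for h in G.
  connectiveOp : ∀ h → NormalOp (signOf h) (map (signOf h ·_) (orderType L h))
  connectiveOp h = record
    { fun = op h
    ; mon = λ i γ {φ} {ψ} p → connective-mono h γ i refl
              (transport (λ t → φ ≤[ t ] ψ) (lookup-map i (signOf h ·_) (orderType L h)) p)
    ; fun-bot = λ i γ →
        transport (λ t → h ⟨ γ ⟩[ i ≔ bot t ] ≤[ signOf h ] bot (signOf h))
          (sym (lookup-map i (signOf h ·_) (orderType L h))) (connective-bot h γ i refl)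
    ; fun-join = λ i γ φ ψ →
        transport (λ t → h ⟨ γ ⟩[ i ≔ join t φ ψ ] ≤[ signOf h ]
                         join (signOf h) (h ⟨ γ ⟩[ i ≔ φ ]) (h ⟨ γ ⟩[ i ≔ ψ ]))
          (sym (lookup-map i (signOf h ·_) (orderType L h))) (connective-join h γ i φ ψ refl) }

-- Interpretation of the expanded language

  open Expansion L

  -- The order-type prescribed for a residual of h is the one it has as an operator on the
  -- extension: its coordinate i takes over the dual of the sign of h, and the signs of the
  -- other coordinates are those of h.
  residual-signs : ∀ s u {n} (η : OrderType n) i →
    map (flip (s · u) ·_) (residual u η i) ≡ map (s ·_) η [ i ]≔ flip s
  residual-signs 𝟏 𝟏 η i = trans (map-[]≔ flip (opposite η) i)
    (cong (_[ i ]≔ ∂) (trans (sym (map-∘ flip flip η)) (map-cong flip-flip η)))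
  residual-signs 𝟏 ∂ η i = trans (map-id (η [ i ]≔ ∂)) (cong (_[ i ]≔ ∂) (sym (map-id η)))
  residual-signs ∂ 𝟏 η i = map-id (opposite η [ i ]≔ 𝟏)
  residual-signs ∂ ∂ η i = map-[]≔ flip η i

  residualOp : ∀ h → Fin (arity L h) → Vec (Elem) (arity L h) → Elem
  residualOp h = Extension.residualExt (connectiveOp h)

  -- The connectives added for the lattice operations are the residuals of ∧ and ∨, those
  -- added for a connective h are the residuals of h.
  connective : ∀ h → Vec (Elem) (arity* h) → Elem
  connective (inj₁ (old f))       = Extension.extension (connectiveOp (inj₁ f))
  connective (inj₁ ≻)             = Extension.residualExt (meetOp ∂) zero
  connective (inj₁ ≺)             = Extension.residualExt (meetOp ∂) (suc zero)
  connective (inj₁ (sharp f i _)) = residualOp (inj₁ f) i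
  connective (inj₁ (flat g j _))  = residualOp (inj₂ g) j
  connective (inj₂ (old g))       = Extension.extension (connectiveOp (inj₂ g))
  connective (inj₂ →ᴴ)            = Extension.residualExt (meetOp 𝟏) (suc zero)
  connective (inj₂ ←ᴴ)            = Extension.residualExt (meetOp 𝟏) zero
  connective (inj₂ (sharp f i _)) = residualOp (inj₁ f) i
  connective (inj₂ (flat g j _))  = residualOp (inj₂ g) j

  -- The sign of coordinate i of the normal operator h.
  coordinate-sign : ∀ h i {u} → ε L h i ≡ u →
    lookup (map (signOf h ·_) (orderType L h)) i ≡ signOf h · u
  coordinate-sign h i e = trans (lookup-map i (signOf h ·_) (orderType L h)) (cong (signOf h ·_) e)

  residualOp-adjoint : ∀ h i {u} → ε L h i ≡ u → ∀ k γ →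
    Adjoint (flip (signOf h · u))
      (lookup (map (flip (signOf h · u) ·_) (residual u (orderType L h) i)) k)
      (λ a → residualOp h i (γ [ k ]≔ a))
  residualOp-adjoint h i {u} e k γ =
    subst₂ (λ s t → Adjoint s t (λ a → residualOp h i (γ [ k ]≔ a)))
      (cong flip (coordinate-sign h i e))
      (cong (λ τ → lookup τ k) (sym (residual-signs (signOf h) u (orderType L h) i)))
      (residualExt-adjoint (connectiveOp h) i k γ)

  -- Every connective of the expanded language has an adjoint in each coordinate. Soundness
  -- of the axioms and of the monotonicity rules for connectives follows from this.
  connective-adjoint : ∀ h i γ {u} → ε L* h i ≡ u →
    Adjoint (signOf h) (signOf h · u) (λ a → connective h (γ [ i ]≔ a))
  connective-adjoint h i γ e =
    transport (λ t → Adjoint (signOf h) t (λ a → connective h (γ [ i ]≔ a)))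
      (trans (lookup-map i (signOf h ·_) (orderType* h)) (cong (signOf h ·_) e)) (at-lookup h i γ)
    where
    at-lookup : ∀ h i γ →
      Adjoint (signOf h) (lookup (map (signOf h ·_) (orderType* h)) i)
        (λ a → connective h (γ [ i ]≔ a))
    at-lookup (inj₁ (old f))       = extension-adjoint (connectiveOp (inj₁ f))
    at-lookup (inj₁ ≻)             = residualExt-adjoint (meetOp ∂) zero
    at-lookup (inj₁ ≺)             = residualExt-adjoint (meetOp ∂) (suc zero)
    at-lookup (inj₁ (sharp f i e)) = residualOp-adjoint (inj₁ f) i e
    at-lookup (inj₁ (flat g j e))  = residualOp-adjoint (inj₂ g) j e
    at-lookup (inj₂ (old g))       = extension-adjoint (connectiveOp (inj₂ g))
    at-lookup (inj₂ →ᴴ)            = residualExt-adjoint (meetOp 𝟏) (suc zero)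
    at-lookup (inj₂ ←ᴴ)            = residualExt-adjoint (meetOp 𝟏) zero
    at-lookup (inj₂ (sharp f i e)) = residualOp-adjoint (inj₁ f) i e
    at-lookup (inj₂ (flat g j e))  = residualOp-adjoint (inj₂ g) j e

  Valuation : Set₂
  Valuation = ℕ → Elem

  ⟦_⟧  : Formula L* → Valuation → Elem
  ⟦_⟧ₛ : ∀ {n} → Vec (Formula L*) n → Valuation → Vec (Elem) n
  ⟦ var p ⟧ v  = v p
  ⟦ ⊥ ⟧ v      = ⌈ ⊥ ⌉
  ⟦ ⊤ ⟧ v      = ⌈ ⊤ ⌉
  ⟦ φ ∧ ψ ⟧ v  = meetₑ 𝟏 (⟦ φ ⟧ v) (⟦ ψ ⟧ v)
  ⟦ φ ∨ ψ ⟧ v  = meetₑ ∂ (⟦ φ ⟧ v) (⟦ ψ ⟧ v)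
  ⟦ op h γ ⟧ v = connective h (⟦ γ ⟧ₛ v)
  ⟦ [] ⟧ₛ v    = []
  ⟦ φ ∷ γ ⟧ₛ v = ⟦ φ ⟧ v ∷ ⟦ γ ⟧ₛ v

  ⟦⟧-update : ∀ {n} (γ : Vec (Formula L*) n) i φ v → ⟦ γ [ i ]≔ φ ⟧ₛ v ≡ ⟦ γ ⟧ₛ v [ i ]≔ ⟦ φ ⟧ v
  ⟦⟧-update (ψ ∷ γ) zero    φ v = refl
  ⟦⟧-update (ψ ∷ γ) (suc i) φ v = cong (⟦ ψ ⟧ v ∷_) (⟦⟧-update γ i φ v)

  ⟦⟧-sub  : ∀ σ φ v → ⟦ sub σ φ ⟧ v ≡ ⟦ φ ⟧ (λ p → ⟦ σ p ⟧ v)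
  ⟦⟧-subs : ∀ {n} σ (γ : Vec (Formula L*) n) v → ⟦ subs σ γ ⟧ₛ v ≡ ⟦ γ ⟧ₛ (λ p → ⟦ σ p ⟧ v)
  ⟦⟧-sub σ (var p)  v = refl
  ⟦⟧-sub σ ⊥        v = refl
  ⟦⟧-sub σ ⊤        v = refl
  ⟦⟧-sub σ (φ ∧ ψ)  v = cong₂ (meetₑ 𝟏) (⟦⟧-sub σ φ v) (⟦⟧-sub σ ψ v)
  ⟦⟧-sub σ (φ ∨ ψ)  v = cong₂ (meetₑ ∂) (⟦⟧-sub σ φ v) (⟦⟧-sub σ ψ v)
  ⟦⟧-sub σ (op h γ) v = cong (connective h) (⟦⟧-subs σ γ v)
  ⟦⟧-subs σ []      v = refl
  ⟦⟧-subs σ (φ ∷ γ) v = cong₂ _∷_ (⟦⟧-sub σ φ v) (⟦⟧-subs σ γ v)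

  infix 4 _⊑_ _⊨_

  _⊑_ : Elem → Elem → Set₁
  a ⊑ b = a ⊑[ 𝟏 ] b

  _⊨_ : Valuation → Sequent L* → Set₁
  v ⊨ (φ ⊢ ψ) = ⟦ φ ⟧ v ⊑ ⟦ ψ ⟧ v

  dual : ∀ {a b} → a ⊑ b ⇔ b ⊑[ ∂ ] a
  dual = ⊑-dual 𝟏

  connectiveOp-residuation : ∀ h i {u} → ε L h i ≡ u →
    ∀ (γ : Vec (Formula L*) (arity L h)) φ ψ v →
    Extension.extension (connectiveOp h) (⟦ γ [ i ]≔ φ ⟧ₛ v) ⊑[ signOf h ] ⟦ ψ ⟧ v ⇔
    ⟦ φ ⟧ v ⊑[ signOf h · u ] residualOp h i (⟦ γ [ i ]≔ ψ ⟧ₛ v)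
  connectiveOp-residuation h i {u} e γ φ ψ v = subst₂
    (λ es es′ → Extension.extension (connectiveOp h) es ⊑[ signOf h ] ⟦ ψ ⟧ v ⇔
                ⟦ φ ⟧ v ⊑[ signOf h · u ] residualOp h i es′)
    (sym (⟦⟧-update γ i φ v)) (sym (⟦⟧-update γ i ψ v))
    (transport (λ t → Extension.extension (connectiveOp h) (⟦ γ ⟧ₛ v [ i ]≔ ⟦ φ ⟧ v)
                        ⊑[ signOf h ] ⟦ ψ ⟧ v ⇔
                      ⟦ φ ⟧ v ⊑[ t ] residualOp h i (⟦ γ ⟧ₛ v [ i ]≔ ⟦ ψ ⟧ v))
      (coordinate-sign h i e)
      (Extension.residuation (connectiveOp h) i (⟦ γ ⟧ₛ v) (⟦ φ ⟧ v) (⟦ ψ ⟧ v)))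

  residuation-sound : ∀ {s t} → Residuation s t → ∀ v → v ⊨ s ⇔ v ⊨ t
  residuation-sound (→ᴴ-adj φ ψ χ) v =
    Extension.residuation (meetOp 𝟏) (suc zero) (⟦ φ ⟧ v ∷ ⟦ ψ ⟧ v ∷ []) (⟦ ψ ⟧ v) (⟦ χ ⟧ v)
  residuation-sound (←ᴴ-adj φ ψ χ) v =
    Extension.residuation (meetOp 𝟏) zero (⟦ φ ⟧ v ∷ ⟦ ψ ⟧ v ∷ []) (⟦ φ ⟧ v) (⟦ χ ⟧ v)
  residuation-sound (≺-adj φ ψ χ) v =
    ⇔-sym dual ⇔-∘ (Extension.residuation (meetOp ∂) (suc zero)
      (⟦ ψ ⟧ v ∷ ⟦ χ ⟧ v ∷ []) (⟦ χ ⟧ v) (⟦ φ ⟧ v) ⇔-∘ dual)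
  residuation-sound (≻-adj φ ψ χ) v =
    ⇔-sym dual ⇔-∘ (Extension.residuation (meetOp ∂) zero
      (⟦ ψ ⟧ v ∷ ⟦ χ ⟧ v ∷ []) (⟦ ψ ⟧ v) (⟦ φ ⟧ v) ⇔-∘ dual)
  residuation-sound (sharp-𝟏 f i e γ φ ψ) v =
    connectiveOp-residuation (inj₁ f) i e γ φ ψ v
  residuation-sound (sharp-∂ f i e γ φ ψ) v =
    ⇔-sym dual ⇔-∘ connectiveOp-residuation (inj₁ f) i e γ φ ψ v
  residuation-sound (flat-𝟏 g j e γ φ ψ) v =
    ⇔-sym dual ⇔-∘ (connectiveOp-residuation (inj₂ g) j e γ ψ φ v ⇔-∘ dual)
  residuation-sound (flat-∂ g j e γ φ ψ) v =
    connectiveOp-residuation (inj₂ g) j e γ ψ φ v ⇔-∘ dual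

  soundness : ∀ {s} → 𝐋* s → ∀ v → v ⊨ s
  soundness (ax p) v = ⊑-refl 𝟏
  soundness (ax-⊥ p) v = bot-⊑ 𝟏
  soundness (ax-⊤ p) v = ⊑-top 𝟏
  soundness (distrib p q r) v =
    adjoint-join (extension-adjoint (meetOp 𝟏) (suc zero) (v p ∷ v q ∷ [])) (v q) (v r)
  soundness (ax-∨₁ p q) v = ⊑-joinₑ₁ 𝟏 (v p) (v q)
  soundness (ax-∨₂ p q) v = ⊑-joinₑ₂ 𝟏 (v p) (v q)
  soundness (ax-∧₁ p q) v = meetₑ-⊑₁ 𝟏 (v p) (v q)
  soundness (ax-∧₂ p q) v = meetₑ-⊑₂ 𝟏 (v p) (v q)
  soundness (f-⊥ f γ i e) v rewrite ⟦⟧-update γ i ⊥ v =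
    adjoint-bot (connective-adjoint (inj₁ f) i (⟦ γ ⟧ₛ v) e)
  soundness (f-∨ f γ i e p q) v
    rewrite ⟦⟧-update γ i (var p ∨ var q) v | ⟦⟧-update γ i (var p) v | ⟦⟧-update γ i (var q) v =
    adjoint-join (connective-adjoint (inj₁ f) i (⟦ γ ⟧ₛ v) e) (v p) (v q)
  soundness (f-⊤ f γ i e) v rewrite ⟦⟧-update γ i ⊤ v =
    adjoint-bot (connective-adjoint (inj₁ f) i (⟦ γ ⟧ₛ v) e)
  soundness (f-∧ f γ i e p q) v
    rewrite ⟦⟧-update γ i (var p ∧ var q) v | ⟦⟧-update γ i (var p) v | ⟦⟧-update γ i (var q) v =
    adjoint-join (connective-adjoint (inj₁ f) i (⟦ γ ⟧ₛ v) e) (v p) (v q)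
  soundness (g-⊤ g γ j e) v rewrite ⟦⟧-update γ j ⊤ v =
    from dual (adjoint-bot (connective-adjoint (inj₂ g) j (⟦ γ ⟧ₛ v) e))
  soundness (g-∧ g γ j e p q) v
    rewrite ⟦⟧-update γ j (var p ∧ var q) v | ⟦⟧-update γ j (var p) v | ⟦⟧-update γ j (var q) v =
    from dual (adjoint-join (connective-adjoint (inj₂ g) j (⟦ γ ⟧ₛ v) e) (v p) (v q))
  soundness (g-⊥ g γ j e) v rewrite ⟦⟧-update γ j ⊥ v =
    from dual (adjoint-bot (connective-adjoint (inj₂ g) j (⟦ γ ⟧ₛ v) e))
  soundness (g-∨ g γ j e p q) v
    rewrite ⟦⟧-update γ j (var p ∨ var q) v | ⟦⟧-update γ j (var p) v | ⟦⟧-update γ j (var q) v =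
    from dual (adjoint-join (connective-adjoint (inj₂ g) j (⟦ γ ⟧ₛ v) e) (v p) (v q))
  soundness (cut d d′) v = ⊑-trans 𝟏 (soundness d v) (soundness d′ v)
  soundness (subst {φ} {ψ} σ d) v
    rewrite ⟦⟧-sub σ φ v | ⟦⟧-sub σ ψ v = soundness d λ p → ⟦ σ p ⟧ v
  soundness (∧-intro d d′) v = meetₑ-greatest 𝟏 (soundness d v) (soundness d′ v)
  soundness (∨-elim d d′) v = joinₑ-least 𝟏 (soundness d v) (soundness d′ v)
  soundness (mono h@(inj₁ _) γ i e {φ} {ψ} d) v
    rewrite ⟦⟧-update γ i φ v | ⟦⟧-update γ i ψ v =
    adjoint-mono (connective-adjoint h i (⟦ γ ⟧ₛ v) e) (soundness d v)
  soundness (mono h@(inj₂ _) γ i e {φ} {ψ} d) v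
    rewrite ⟦⟧-update γ i φ v | ⟦⟧-update γ i ψ v =
    from dual (adjoint-mono (connective-adjoint h i (⟦ γ ⟧ₛ v) e) (to dual (soundness d v)))
  soundness (anti h@(inj₁ _) γ i e {φ} {ψ} d) v
    rewrite ⟦⟧-update γ i φ v | ⟦⟧-update γ i ψ v =
    adjoint-mono (connective-adjoint h i (⟦ γ ⟧ₛ v) e) (to dual (soundness d v))
  soundness (anti h@(inj₂ _) γ i e {φ} {ψ} d) v
    rewrite ⟦⟧-update γ i φ v | ⟦⟧-update γ i ψ v =
    from dual (adjoint-mono (connective-adjoint h i (⟦ γ ⟧ₛ v) e) (soundness d v))
  soundness (rule (fwd r) d) v = to (residuation-sound r v) (soundness d v)
  soundness (rule (bwd r) d) v = from (residuation-sound r v) (soundness d v)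

  -- Conservativity

  -- Each variable denotes its own class in the Lindenbaum algebra.
  canonical : Valuation
  canonical p = ⌈ var p ⌉

  truth  : ∀ φ → Represents (⟦ embed φ ⟧ canonical) φ
  truths : ∀ {n} (γ : Vec (Formula L) n) i →
           Represents (lookup (⟦ embeds γ ⟧ₛ canonical) i) (lookup γ i)
  truth (var p) = ⌈⌉-represents (var p)
  truth ⊥       = ⌈⌉-represents ⊥
  truth ⊤       = ⌈⌉-represents ⊤
  truth (φ ∧ ψ) = extension-represents (meetOp 𝟏)
    (⟦ embeds (φ ∷ ψ ∷ []) ⟧ₛ canonical) (φ ∷ ψ ∷ [])
    λ { zero → truth φ ; (suc zero) → truth ψ }
  truth (φ ∨ ψ) = extension-represents (meetOp ∂)
    (⟦ embeds (φ ∷ ψ ∷ []) ⟧ₛ canonical) (φ ∷ ψ ∷ [])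
    λ { zero → truth φ ; (suc zero) → truth ψ }
  truth (op (inj₁ f) γ) = extension-represents (connectiveOp (inj₁ f))
    (⟦ embeds γ ⟧ₛ canonical) γ (truths γ)
  truth (op (inj₂ g) γ) = extension-represents (connectiveOp (inj₂ g))
    (⟦ embeds γ ⟧ₛ canonical) γ (truths γ)
  truths (φ ∷ γ) zero    = truth φ
  truths (φ ∷ γ) (suc i) = truths γ i

  conservative : ∀ φ ψ → 𝐋* (embed φ ⊢ embed ψ) → 𝐋 L (φ ⊢ ψ)
  conservative φ ψ d = represents-⊑ φ ψ (truth φ) (truth ψ) (soundness d canonical)

-- Embedding of derivations

module _ (L : DLELanguage) where

  open Expansion L

  embeds-update : ∀ {n} (γ : Vec (Formula L) n) i φ → embeds (γ [ i ]≔ φ) ≡ embeds γ [ i ]≔ embed φ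
  embeds-update (ψ ∷ γ) zero    φ = refl
  embeds-update (ψ ∷ γ) (suc i) φ = cong (embed ψ ∷_) (embeds-update γ i φ)

  embed-sub  : ∀ σ φ → embed (sub σ φ) ≡ sub (embed ∘ σ) (embed φ)
  embed-subs : ∀ {n} σ (γ : Vec (Formula L) n) → embeds (subs σ γ) ≡ subs (embed ∘ σ) (embeds γ)
  embed-sub σ (var p) = refl
  embed-sub σ ⊥       = refl
  embed-sub σ ⊤       = refl
  embed-sub σ (φ ∧ ψ) = cong₂ _∧_ (embed-sub σ φ) (embed-sub σ ψ)
  embed-sub σ (φ ∨ ψ) = cong₂ _∨_ (embed-sub σ φ) (embed-sub σ ψ)
  embed-sub σ (op (inj₁ f) γ) = cong (op (inj₁ (old f))) (embed-subs σ γ)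
  embed-sub σ (op (inj₂ g) γ) = cong (op (inj₂ (old g))) (embed-subs σ γ)
  embed-subs σ []      = refl
  embed-subs σ (φ ∷ γ) = cong₂ _∷_ (embed-sub σ φ) (embed-subs σ γ)

  extends : ∀ {φ ψ} → 𝐋 L (φ ⊢ ψ) → 𝐋* (embed φ ⊢ embed ψ)
  extends (ax p) = ax p
  extends (ax-⊥ p) = ax-⊥ p
  extends (ax-⊤ p) = ax-⊤ p
  extends (distrib p q r) = distrib p q r
  extends (ax-∨₁ p q) = ax-∨₁ p q
  extends (ax-∨₂ p q) = ax-∨₂ p q
  extends (ax-∧₁ p q) = ax-∧₁ p q
  extends (ax-∧₂ p q) = ax-∧₂ p q
  extends (f-⊥ f γ i e) rewrite embeds-update γ i ⊥ = f-⊥ (old f) (embeds γ) i e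
  extends (f-∨ f γ i e p q)
    rewrite embeds-update γ i (var p ∨ var q) | embeds-update γ i (var p) | embeds-update γ i (var q) =
    f-∨ (old f) (embeds γ) i e p q
  extends (f-⊤ f γ i e) rewrite embeds-update γ i ⊤ = f-⊤ (old f) (embeds γ) i e
  extends (f-∧ f γ i e p q)
    rewrite embeds-update γ i (var p ∧ var q) | embeds-update γ i (var p) | embeds-update γ i (var q) =
    f-∧ (old f) (embeds γ) i e p q
  extends (g-⊤ g γ j e) rewrite embeds-update γ j ⊤ = g-⊤ (old g) (embeds γ) j e
  extends (g-∧ g γ j e p q)
    rewrite embeds-update γ j (var p ∧ var q) | embeds-update γ j (var p) | embeds-update γ j (var q) =
    g-∧ (old g) (embeds γ) j e p q
  extends (g-⊥ g γ j e) rewrite embeds-update γ j ⊥ = g-⊥ (old g) (embeds γ) j e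
  extends (g-∨ g γ j e p q)
    rewrite embeds-update γ j (var p ∨ var q) | embeds-update γ j (var p) | embeds-update γ j (var q) =
    g-∨ (old g) (embeds γ) j e p q
  extends (cut d d′) = cut (extends d) (extends d′)
  extends (subst {φ} {ψ} σ d)
    rewrite embed-sub σ φ | embed-sub σ ψ = subst (embed ∘ σ) (extends d)
  extends (∧-intro d d′) = ∧-intro (extends d) (extends d′)
  extends (∨-elim d d′) = ∨-elim (extends d) (extends d′)
  extends (mono (inj₁ f) γ i e {φ} {ψ} d)
    rewrite embeds-update γ i φ | embeds-update γ i ψ = mono (inj₁ (old f)) (embeds γ) i e (extends d)
  extends (mono (inj₂ g) γ i e {φ} {ψ} d)
    rewrite embeds-update γ i φ | embeds-update γ i ψ = mono (inj₂ (old g)) (embeds γ) i e (extends d)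
  extends (anti (inj₁ f) γ i e {φ} {ψ} d)
    rewrite embeds-update γ i φ | embeds-update γ i ψ = anti (inj₁ (old f)) (embeds γ) i e (extends d)
  extends (anti (inj₂ g) γ i e {φ} {ψ} d)
    rewrite embeds-update γ i φ | embeds-update γ i ψ = anti (inj₂ (old g)) (embeds γ) i e (extends d)

theorem4 : (L : DLELanguage) (φ ψ : Formula L) →
    𝐋 L (φ ⊢ ψ) ⇔ Expansion.𝐋* L (Expansion.embed L φ ⊢ Expansion.embed L ψ)
theorem4 L φ ψ = mk⇔ (extends L) (Semantics.conservative L φ ψ)
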